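{- Let $r\ge 2$ and $k\ge r+2$ be integers, and let $n=pk+q$ with integers $p\ge 0$ and $0\le q<k$. Then for every $P_k$-free red-blue graph $G$ on $n$ vertices, $$g(G)\le p\binom{k}{r}+\begin{cases}\binom{q}{r} & \text{if } q\ge r+2,\\ \binom{q}{2} & \text{if } q\le r+2.\end{cases}$$ Furthermore, for every such $n$ there is a $P_k$-free red-blue graph on $n$ vertices attaining this bound.
   Context: $P_k$ denotes the path with $k$ edges. A red-blue graph is a (simple) graph each of whose edges is colored red or blue; it is $P_k$-free if its underlying uncolored graph contains no copy of $P_k$. For a red-blue graph $G$, let $G_r$ be the subgraph of red edges and $G_b$ the subgraph of blue edges, and define $g(G)=\mathcal{N}(K_r,G_b)+e(G_r)$, where $\mathcal{N}(K_r,G_b)$ is the number of copies of the complete graph $K_r$ in $G_b$ and $e(G_r)$ is the number of red edges. -}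

module Defs where

open import Data.Nat using (ℕ; zero; suc; _+_; _*_; _≤_; _<_)
open import Data.Nat.Combinatorics using (_C_)
open import Data.Bool using (Bool; true; false; _∧_; _∨_; not; if_then_else_)
open import Data.Fin using (Fin; zero; suc; inject₁; _<?_)
open import Data.Fin.Properties using (_≟_)
open import Data.List using (List; []; _∷_; _++_; map; filter; length; allFin)
open import Data.Vec using (Vec; []; _∷_; lookup; count)
open import Data.Product using (Σ; _×_)
open import Relation.Nullary using (¬_; does)
open import Relation.Nullary.Decidable using (⌊_⌋)
open import Relation.Binary.PropositionalEquality using (_≡_; _≢_)
open import Function.Definitions using (Injective)

data Col : Set where
  none red blue : Col

isRed isBlue : Col → Bool
isRed red = true
isRed _ = false
isBlue blue = true
isBlue _ = false

record RBGraph (n : ℕ) : Set where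
  field
    col  : Fin n → Fin n → Col
    symm : ∀ i j → col i j ≡ col j i
    irr  : ∀ i → col i i ≡ none
open RBGraph public

Adj : ∀ {n} → RBGraph n → Fin n → Fin n → Set
Adj G i j = col G i j ≢ none

-- P_k (the path with k edges) in the underlying graph: k+1 distinct vertices,
-- consecutive ones adjacent.
PathFree : ∀ {n} → ℕ → RBGraph n → Set
PathFree {n} k G =
  ¬ (Σ (Fin (suc k) → Fin n) λ v →
      Injective _≡_ _≡_ v × (∀ (i : Fin k) → Adj G (v (inject₁ i)) (v (suc i))))

redEdges : ∀ {n} → RBGraph n → ℕ
redEdges {n} G = length (filter (λ ij → does (ij .Data.Product.proj₁ <? ij .Data.Product.proj₂)
                                         Data.Bool.∧ isRed (col G (ij .Data.Product.proj₁) (ij .Data.Product.proj₂)) Data.Bool.≟ true)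
                                 pairs)
  where
  pairs : List (Σ (Fin n) λ _ → Fin n)
  pairs = Data.List.concatMap (λ i → map (λ j → i Data.Product., j) (allFin n)) (allFin n)

allB : {A : Set} → (A → Bool) → List A → Bool
allB p [] = true
allB p (x ∷ xs) = p x ∧ allB p xs

allSubsets : (n : ℕ) → List (Vec Bool n)
allSubsets zero = [] ∷ []
allSubsets (suc n) = map (false ∷_) (allSubsets n) ++ map (true ∷_) (allSubsets n)

size : ∀ {n} → Vec Bool n → ℕ
size [] = 0
size (true ∷ s) = suc (size s)
size (false ∷ s) = size s

blueClique : ∀ {n} → RBGraph n → Vec Bool n → Bool
blueClique {n} G S =
  allB (λ i → allB (λ j → not (lookup S i ∧ lookup S j ∧ not ⌊ i ≟ j ⌋) ∨ isBlue (col G i j))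
                 (allFin n)) (allFin n)

blueCliques : ∀ {n} → ℕ → RBGraph n → ℕ
blueCliques {n} r G =
  length (filter (λ S → ⌊ size S Data.Nat.≟ r ⌋ ∧ blueClique G S Data.Bool.≟ true) (allSubsets n))

g : ∀ {n} → ℕ → RBGraph n → ℕ
g r G = blueCliques r G + redEdges G

bound : ℕ → ℕ → ℕ → ℕ → ℕ
bound r k p q = p * (k C r) + (if ⌊ suc (suc r) Data.Nat.≤? q ⌋ then q C r else q C 2)

{-# OPTIONS --safe #-}
module Submission where

-- A P_k-free graph with the most weight may be assumed saturated (add red edges) and, by
-- superadditivity of the bound, connected on n > k vertices.  If k vertices of degree at most
-- t = ⌊(k-1)/2⌋ can be deleted one after another, they cost at most C(k,r) altogether and
-- induction applies.  Otherwise the (t+1)-core H is nonempty.  Two nonadjacent vertices x, y of a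
-- saturated graph start disjoint paths on at least k + 1 vertices together; choosing these paths
-- maximal, an Ore-type crossing argument contradicts d(x) + d(y) ≥ k.  Hence H is a clique, and
-- (Kopylov) with s = |H| the same argument shows that all other vertices can be deleted in an order
-- in which each has degree at most c = k - s.  Convexity of the extremal function then gives
-- g(G) ≤ C(k,r) + f(n-k), where f(q) = max(C(q,r), C(q,2)).

open import Defs
open import Data.Bool using (Bool; true; false; if_then_else_; not; _∧_; _∨_; T; T?)
import Data.Bool as Bool
open import Data.Bool.Properties using (∨-comm; ∧-comm)
open import Data.Empty using (⊥; ⊥-elim)
open import Data.Fin using (Fin; zero; suc; toℕ; fromℕ<; inject₁; inject≤) renaming (_<?_ to _<ᶠ?_)
open import Data.Fin.Induction using (<-weakInduction)
open import Data.Fin.Properties using (inject≤-injective; toℕ-inject≤; toℕ-inject₁; toℕ-injective; fromℕ<-injective; pigeonhole) renaming (_≟_ to _≟ᶠ_; suc-injective to Fin-suc-injective)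
open import Data.List using (List; []; _∷_; _++_; _∷ʳ_; _ʳ++_; map; length; lookup; filter; filterᵇ; allFin; concatMap; tabulate; InitLast; initLast; _∷ʳ′_)
open import Data.List.Membership.Propositional using (_∈_; _∉_; find; lose)
import Data.List.Membership.DecPropositional as DecMembership
open import Data.List.Membership.Propositional.Properties using (∈-∃++; ∈-++⁺ˡ; ∈-++⁺ʳ; ∈-++⁻; ∈-filter⁺; ∈-filter⁻; ∈-allFin; ∈-lookup)
open import Data.List.Properties using (length-++; length-map; length-tabulate; map-tabulate; tabulate-cong; ∷ʳ-injectiveʳ; ++-assoc; ++-identityʳ)
open import Data.List.Relation.Binary.Permutation.Propositional using (_↭_; ↭-trans; ↭-sym; ↭-reflexive) renaming (refl to ↭refl; prep to ↭prep; swap to ↭swap; trans to ↭trans)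
open import Data.List.Relation.Binary.Permutation.Propositional.Properties using (↭-length; filter-↭; All-resp-↭; ∈-resp-↭; ++↭ʳ++; shift; ++⁺ˡ) renaming (++-comm to ↭-++-comm)
open import Data.List.Relation.Unary.All as All using (All; []; _∷_)
open import Data.List.Relation.Unary.AllPairs as AllPairs using (AllPairs; []; _∷_)
open import Data.List.Relation.Unary.Any using (Any; here; there; any?)
open import Data.List.Relation.Unary.Linked using (Linked; []; [-]; _∷_)
open import Data.List.Relation.Unary.Linked.Properties using (AllPairs⇒Linked)
open import Data.List.Relation.Unary.Unique.Propositional using (Unique)
open import Data.List.Relation.Unary.Unique.Propositional.Properties using (allFin⁺) renaming (++⁺ to Unique-++⁺; filter⁺ to Unique-filter⁺)
open import Data.Nat
open import Data.Nat.Combinatorics using (_C_; nCk≡nC[n∸k]; nCn≡1; k>n⇒nCk≡0; nCk+nC[k+1]≡[n+1]C[k+1])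
open import Data.Nat.Divisibility using (divides-refl)
open import Data.Nat.DivMod
open import Data.Nat.Properties
open import Data.Nat.Tactic.RingSolver using (solve-∀)
open import Data.Product using (Σ; ∃; _×_; _,_; proj₁; proj₂)
open import Data.Sum using (_⊎_; inj₁; inj₂; [_,_]′; map₁)
open import Data.Vec using (Vec; []; _∷_) renaming (lookup to lookupᵛ)
open import Function using (_∘_)
open import Relation.Binary.Definitions using (DecidableEquality)
open import Relation.Binary.PropositionalEquality using (_≡_; _≢_; refl; sym; trans; cong; cong₂; subst; subst₂; module ≡-Reasoning)
open import Relation.Nullary using (¬_; Dec; yes; no; does; contradiction)
open import Relation.Nullary.Decidable using (⌊_⌋; _×-dec_; ¬?; decidable-stable)

-- Colours enter through arithmetic: a vertex with b blue and e red edges takes away at most C(b,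
-- r-1) + e, which is at most `cost (b + e)`, so that only degrees have to be controlled. The
-- obstacle is the kink of f at r + 2. For r ≥ 3 a vertex of degree r + 1 may cost more than f gains
-- from r + 1 to r + 2 vertices, so costs are not increments of f. What survives is f(c+1) - f(c) ≤
-- `cost c` ≤ f(c+2) - f(c+1), and convexity is drawn from this.
--
-- The constants are balanced. The number t is the largest with 2t < k, which makes k cheap
-- deletions affordable, while 2(t+1) ≥ k feeds the crossing argument; c = k - s gives (s-1) + (c+1)
-- = k.
--
-- Degrees are known only inside H or inside what a deletion process leaves. The crossing argument
-- therefore counts restricted neighbourhoods and must keep the initial vertices of the paths in
-- prescribed sets. Connectedness serves one purpose: it links two disjoint cycles that cannot be
-- shortened.

private
  variable
    A B : Set

-- Binomial coefficients; comparison of C(n, r) with C(n, 2)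

binom : ℕ → ℕ → ℕ
binom n       zero    = 1
binom zero    (suc k) = 0
binom (suc n) (suc k) = binom n k + binom n (suc k)

binom≡C : ∀ n k → binom n k ≡ n C k
binom≡C n zero = sym (trans (nCk≡nC[n∸k] {k = 0} {n = n} z≤n) (nCn≡1 n))
binom≡C zero (suc k) = sym (k>n⇒nCk≡0 {0} {suc k} (s≤s z≤n))
binom≡C (suc n) (suc k) =
  trans (cong₂ _+_ (binom≡C n k) (binom≡C n (suc k))) (nCk+nC[k+1]≡[n+1]C[k+1] n k)

binom-mono : ∀ {n p} k → n ≤ p → binom n k ≤ binom p k
binom-mono zero _ = ≤-refl
binom-mono {zero} (suc k) _ = z≤n
binom-mono {suc n} {suc p} (suc k) (s≤s n≤p) = +-mono-≤ (binom-mono k n≤p) (binom-mono (suc k) n≤p)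

binom-pos : ∀ {n k} → k ≤ n → 1 ≤ binom n k
binom-pos z≤n = ≤-refl
binom-pos {suc n} {suc k} (s≤s k≤n) = ≤-trans (binom-pos k≤n) (m≤m+n _ _)

binom-zero : ∀ {n k} → n < k → binom n k ≡ 0
binom-zero {zero} (s≤s _) = refl
binom-zero {suc n} (s≤s n<k) = cong₂ _+_ (binom-zero n<k) (binom-zero (m<n⇒m<1+n n<k))

binom-diag : ∀ n → binom n n ≡ 1
binom-diag zero = refl
binom-diag (suc n) = cong₂ _+_ (binom-diag n) (binom-zero (n<1+n n))

binom-one : ∀ n → binom n 1 ≡ n
binom-one zero = refl
binom-one (suc n) = cong suc (binom-one n)

binom-codiag : ∀ n → binom (suc n) n ≡ suc n
binom-codiag zero = refl
binom-codiag (suc n) = trans (cong₂ _+_ (binom-codiag n) (binom-diag (suc n))) (+-comm (suc n) 1)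

binom-suc-two : ∀ n → binom (suc n) 2 ≡ n + binom n 2
binom-suc-two n = cong (_+ binom n 2) (binom-one n)

twice-binom-two : ∀ n → 2 * binom (suc n) 2 ≡ suc n * n
twice-binom-two zero = refl
twice-binom-two (suc n) = begin
  2 * binom (2 + n) 2             ≡⟨ cong (2 *_) (binom-suc-two (suc n)) ⟩
  2 * (suc n + binom (suc n) 2)   ≡⟨ *-distribˡ-+ 2 (suc n) _ ⟩
  2 * suc n + 2 * binom (suc n) 2 ≡⟨ cong (2 * suc n +_) (twice-binom-two n) ⟩
  2 * suc n + suc n * n           ≡⟨ lemma n ⟩
  (2 + n) * suc n                 ∎
  where
  open ≡-Reasoning
  lemma : ∀ n → 2 * suc n + suc n * n ≡ (2 + n) * suc n
  lemma = solve-∀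

absorption : ∀ n k → suc k * binom (suc n) (suc k) ≡ suc n * binom n k
absorption zero zero = refl
absorption zero (suc k) = *-zeroʳ (2 + k)
absorption (suc n) zero = trans (+-identityʳ _) (trans (cong suc (binom-one (suc n))) (sym (*-identityʳ _)))
absorption (suc n) (suc k) = begin
  (2 + k) * (x + y)                   ≡⟨ lemma₁ k x y ⟩
  suc k * x + x + (2 + k) * y         ≡⟨ cong₂ (λ u v → u + x + v) (absorption n k) (absorption n (suc k)) ⟩
  suc n * a + (a + b) + suc n * b     ≡⟨ lemma₂ n a b ⟩
  (2 + n) * (a + b)                   ∎
  where
  open ≡-Reasoning
  a b x y : ℕ
  a = binom n k
  b = binom n (suc k)
  x = binom (suc n) (suc k)
  y = binom (suc n) (2 + k)
  lemma₁ : ∀ k x y → (2 + k) * (x + y) ≡ suc k * x + x + (2 + k) * y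
  lemma₁ = solve-∀
  lemma₂ : ∀ n a b → suc n * a + (a + b) + suc n * b ≡ (2 + n) * (a + b)
  lemma₂ = solve-∀

-- In Vandermonde's sum for C(2c, m) each of the m + 1 terms C(c, i) C(c, m-i) is at least C(c, m)
-- when m ≤ c. The induction avoids the sum: the slack `m * x` raises the coefficient of x to
-- 2(m+1), enough for two copies of the hypothesis at m, and Pascal's rule on the right provides the
-- room.
binom-double : ∀ c m → suc m * binom c m ≤ binom (c + c) m
binom-double c zero = ≤-refl
binom-double zero (suc m) = ≤-reflexive (*-zeroʳ (2 + m))
binom-double (suc c) (suc m) = begin
  (2 + m) * (x + y)                                 ≤⟨ m≤m+n _ (m * x) ⟩
  (2 + m) * (x + y) + m * x                         ≡⟨ lemma₁ m x y ⟩
  suc m * x + suc m * x + (2 + m) * y               ≤⟨ +-mono-≤ (+-mono-≤ (binom-double c m) (binom-double c m)) (binom-double c (suc m)) ⟩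
  u + u + v                                         ≡⟨ +-assoc u u v ⟩
  u + (u + v)                                       ≤⟨ +-monoˡ-≤ (u + v) (binom-mono m (n≤1+n (c + c))) ⟩
  binom (suc (c + c)) m + (u + v)                   ≡⟨ cong (λ z → binom (suc z) (suc m)) (sym (+-suc c c)) ⟩
  binom (suc (c + suc c)) (suc m)                   ∎
  where
  open ≤-Reasoning
  x y u v : ℕ
  x = binom c m
  y = binom c (suc m)
  u = binom (c + c) m
  v = binom (c + c) (suc m)
  lemma₁ : ∀ m x y → (2 + m) * (x + y) + m * x ≡ suc m * x + suc m * x + (2 + m) * y
  lemma₁ = solve-∀

n≤binom : ∀ {n m} → 1 ≤ m → m < n → n ≤ binom n m
n≤binom {suc n} {suc m} 1≤m (s≤s m≤n) with m≤n⇒m<n∨m≡n m≤n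
... | inj₁ m<n = +-mono-≤ (binom-pos {n} {m} (<⇒≤ m≤n)) (n≤binom 1≤m m<n)
... | inj₂ refl = ≤-reflexive (sym (binom-codiag (suc m)))

binom≤n : ∀ {n m} → 1 ≤ m → n ≤ suc m → binom n m ≤ n
binom≤n {n} {m} 1≤m n≤1+m with m≤n⇒m<n∨m≡n n≤1+m
... | inj₂ refl = ≤-reflexive (binom-codiag m)
... | inj₁ (s≤s n≤m) with m≤n⇒m<n∨m≡n n≤m
...   | inj₁ n<m = ≤-trans (≤-reflexive (binom-zero n<m)) z≤n
...   | inj₂ refl = ≤-trans (≤-reflexive (binom-diag n)) 1≤m

binom-subdiag : ∀ n → binom (2 + n) n ≡ binom (2 + n) 2
binom-subdiag zero = refl
binom-subdiag (suc n) = begin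
  binom (2 + n) n + binom (2 + n) (suc n)  ≡⟨ cong₂ _+_ (binom-subdiag n) (binom-codiag (suc n)) ⟩
  binom (2 + n) 2 + (2 + n)                ≡⟨ +-comm _ (2 + n) ⟩
  (2 + n) + binom (2 + n) 2                ≡⟨ binom-suc-two (2 + n) ⟨
  binom (3 + n) 2                          ∎
  where open ≡-Reasoning

-- At n = r + 2 the two agree by symmetry. Beyond that point C(n, r) gains C(n, r-1) ≥ n per step,
-- and C(n, 2) gains n.
binom-two≤binom : ∀ {n r} → 2 ≤ r → 2 + r ≤ n → binom n 2 ≤ binom n r
binom-two≤binom {suc n} {suc r} 2≤r 2+r≤n with m≤n⇒m<n∨m≡n 2+r≤n
... | inj₂ refl = ≤-reflexive (sym (binom-subdiag (suc r)))
... | inj₁ (s≤s 2+r<n) = begin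
  binom (suc n) 2                 ≡⟨ binom-suc-two n ⟩
  n + binom n 2                   ≤⟨ +-mono-≤ (n≤binom (≤-pred 2≤r) (<-trans (n<1+n r) (<-trans (n<1+n _) 2+r<n))) (binom-two≤binom 2≤r 2+r<n) ⟩
  binom n r + binom n (suc r)     ∎
  where open ≤-Reasoning

binom≤binom-two : ∀ {n r} → 2 ≤ r → n < 2 + r → binom n r ≤ binom n 2
binom≤binom-two {n} {r} 2≤r (s≤s n≤1+r) with m≤n⇒m<n∨m≡n n≤1+r
... | inj₁ (s≤s n≤r) with m≤n⇒m<n∨m≡n n≤r
...   | inj₁ n<r = ≤-trans (≤-reflexive (binom-zero n<r)) z≤n
...   | inj₂ refl = ≤-trans (≤-reflexive (binom-diag n)) (binom-pos 2≤r)
binom≤binom-two {r = r} 2≤r (s≤s n≤1+r) | inj₂ refl = begin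
  binom (suc r) r   ≡⟨ binom-codiag r ⟩
  1 + r             ≤⟨ +-monoˡ-≤ r (binom-pos 2≤r) ⟩
  binom r 2 + r     ≡⟨ +-comm (binom r 2) r ⟩
  r + binom r 2     ≡⟨ binom-suc-two r ⟨
  binom (suc r) 2   ∎
  where open ≤-Reasoning

-- Convexity of the extremal weights

-- With r = 2 + ρ: weight n is the maximum of g over all red-blue graphs on n vertices,
-- cost d bounds the loss of g when a vertex of degree d is deleted.
module Weights (ρ : ℕ) where

  r : ℕ
  r = 2 + ρ

  weight cost : ℕ → ℕ
  weight n = binom n r ⊔ binom n 2
  cost d = binom d (suc ρ) ⊔ d

  weight-large : ∀ {n} → 2 + r ≤ n → weight n ≡ binom n r
  weight-large h = m≥n⇒m⊔n≡m (binom-two≤binom (s≤s (s≤s z≤n)) h)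

  weight-small : ∀ {n} → n < 2 + r → weight n ≡ binom n 2
  weight-small h = m≤n⇒m⊔n≡n (binom≤binom-two (s≤s (s≤s z≤n)) h)

  cost-mono : ∀ {c d} → c ≤ d → cost c ≤ cost d
  cost-mono c≤d = ⊔-mono-≤ (binom-mono (suc ρ) c≤d) c≤d

  cost-small : ∀ {d} → d ≤ r → cost d ≤ d
  cost-small d≤r = ⊔-lub (binom≤n (s≤s z≤n) d≤r) ≤-refl

  -- For a given degree the worst vertex is monochromatic. If C(x, r-1) ≤ x, all edges may be
  -- counted as red. Otherwise C(x, r-1) is positive, so x ≥ r - 2, and each red edge counted as
  -- blue instead adds some C(z, r-2) ≥ 1.
  split-cost : ∀ x y → binom x (suc ρ) + y ≤ cost (x + y)
  split-cost x y with binom x (suc ρ) ≤? x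
  ... | yes h = ≤-trans (+-monoˡ-≤ y h) (m≤n⊔m _ _)
  ... | no h = ≤-trans (grow y) (m≤m⊔n _ _)
    where
    ρ≤x : ρ ≤ x
    ρ≤x with ρ ≤? x
    ... | yes p = p
    ... | no p = contradiction (≤-trans (≤-reflexive (binom-zero (m<n⇒m<1+n (≰⇒> p)))) z≤n) h
    grow : ∀ y → binom x (suc ρ) + y ≤ binom (x + y) (suc ρ)
    grow zero = ≤-reflexive (trans (+-identityʳ _) (cong (λ z → binom z (suc ρ)) (sym (+-identityʳ x))))
    grow (suc y) = begin
      binom x (suc ρ) + suc y                  ≡⟨ +-suc _ y ⟩
      1 + (binom x (suc ρ) + y)                ≤⟨ +-mono-≤ (binom-pos (≤-trans ρ≤x (m≤m+n x y))) (grow y) ⟩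
      binom (suc (x + y)) (suc ρ)              ≡⟨ cong (λ z → binom z (suc ρ)) (sym (+-suc x y)) ⟩
      binom (x + suc y) (suc ρ)                ∎
      where open ≤-Reasoning

  weight-suc≤ : ∀ i → weight (suc i) ≤ weight i + cost i
  weight-suc≤ i = ⊔-lub cliques edges
    where
    cliques : binom (suc i) r ≤ weight i + cost i
    cliques = ≤-trans (≤-reflexive (+-comm (binom i (suc ρ)) (binom i r)))
      (+-mono-≤ (m≤m⊔n (binom i r) _) (m≤m⊔n (binom i (suc ρ)) _))
    edges : binom (suc i) 2 ≤ weight i + cost i
    edges = ≤-trans (≤-reflexive (trans (binom-suc-two i) (+-comm i (binom i 2))))
      (+-mono-≤ (m≤n⊔m (binom i r) (binom i 2)) (m≤n⊔m (binom i (suc ρ)) i))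

  -- For r ≥ 3 the bound fails at i = c = r + 1.
  weight-step : ∀ {i c} → c < i ⊎ (c ≤ i × i ≢ suc r) → weight i + cost c ≤ weight (suc i)
  weight-step {i} {c} h with 2 + r ≤? i
  ... | yes 2+r≤i = begin
    weight i + cost c                ≡⟨ cong (_+ cost c) (weight-large 2+r≤i) ⟩
    binom i r + cost c               ≤⟨ +-monoʳ-≤ (binom i r) (≤-trans (cost-mono c≤i) cost≤) ⟩
    binom i r + binom i (suc ρ)      ≡⟨ +-comm (binom i r) _ ⟩
    binom (suc i) r                  ≤⟨ m≤m⊔n _ _ ⟩
    weight (suc i)                   ∎
    where
    open ≤-Reasoning
    c≤i : c ≤ i
    c≤i = [ <⇒≤ , proj₁ ]′ h
    cost≤ : cost i ≤ binom i (suc ρ)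
    cost≤ = ⊔-lub ≤-refl (n≤binom (s≤s z≤n) (≤-trans (n≤1+n _) (≤-trans (n≤1+n _) 2+r≤i)))
  ... | no 2+r≰i = begin
    weight i + cost c                ≡⟨ cong (_+ cost c) (weight-small (≰⇒> 2+r≰i)) ⟩
    binom i 2 + cost c               ≤⟨ +-monoʳ-≤ (binom i 2) (≤-trans (cost-small c≤r) c≤i) ⟩
    binom i 2 + i                    ≡⟨ +-comm (binom i 2) i ⟩
    i + binom i 2                    ≡⟨ binom-suc-two i ⟨
    binom (suc i) 2                  ≤⟨ m≤n⊔m _ _ ⟩
    weight (suc i)                   ∎
    where
    open ≤-Reasoning
    i≤1+r : i ≤ suc r
    i≤1+r = ≤-pred (≰⇒> 2+r≰i)
    c≤i : c ≤ i
    c≤i = [ <⇒≤ , proj₁ ]′ h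
    c≤r : c ≤ r
    c≤r = [ (λ c<i → ≤-pred (≤-trans c<i i≤1+r))
                   , (λ (p , q) → ≤-trans p (≤-pred (≤∧≢⇒< i≤1+r q))) ]′ h

  weight-steps : ∀ {c} i d → c < i → weight i + d * cost c ≤ weight (i + d)
  weight-steps {c} i zero c<i = ≤-reflexive (trans (+-identityʳ _) (cong weight (sym (+-identityʳ i))))
  weight-steps {c} i (suc d) c<i = begin
    weight i + (cost c + d * cost c)   ≡⟨ lemma (weight i) (cost c) (d * cost c) ⟩
    weight i + d * cost c + cost c     ≤⟨ +-monoˡ-≤ (cost c) (weight-steps i d c<i) ⟩
    weight (i + d) + cost c            ≤⟨ weight-step (inj₁ (≤-trans c<i (m≤m+n i d))) ⟩
    weight (suc (i + d))               ≡⟨ cong weight (sym (+-suc i d)) ⟩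
    weight (i + suc d)                 ∎
    where
    open ≤-Reasoning
    lemma : ∀ a b e → a + (b + e) ≡ a + e + b
    lemma = solve-∀

  -- `cost x` separates the two increments: it is at least the one at x and at most the one at any y
  -- > x. Equal arguments are treated apart, so the exceptional case of `weight-step` never arises.
  weight-convex-suc : ∀ {x y} → x ≤ y → weight (suc x) + weight y ≤ weight x + weight (suc y)
  weight-convex-suc {x} {y} x≤y with m≤n⇒m<n∨m≡n x≤y
  ... | inj₂ refl = ≤-reflexive (+-comm _ (weight x))
  ... | inj₁ x<y = begin
    weight (suc x) + weight y           ≤⟨ +-monoˡ-≤ (weight y) (weight-suc≤ x) ⟩
    weight x + cost x + weight y        ≡⟨ lemma (weight x) (cost x) (weight y) ⟩
    weight x + (weight y + cost x)      ≤⟨ +-monoʳ-≤ (weight x) (weight-step (inj₁ x<y)) ⟩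
    weight x + weight (suc y)           ∎
    where
    open ≤-Reasoning
    lemma : ∀ a b e → a + b + e ≡ a + (e + b)
    lemma = solve-∀

  weight-convex : ∀ {x y} d → x ≤ y → weight (x + d) + weight y ≤ weight x + weight (y + d)
  weight-convex {x} {y} zero x≤y = ≤-reflexive (cong₂ (λ u v → weight u + weight v) (+-identityʳ x) (sym (+-identityʳ y)))
  weight-convex {x} {y} (suc d) x≤y = +-cancelʳ-≤ (weight (x + d) + weight (y + d)) _ _ (begin
    weight (x + suc d) + weight y + (weight (x + d) + weight (y + d))
      ≡⟨ cong (λ z → weight z + weight y + (weight (x + d) + weight (y + d))) (+-suc x d) ⟩
    weight (suc (x + d)) + weight y + (weight (x + d) + weight (y + d))
      ≡⟨ lemma₁ (weight (suc (x + d))) (weight y) (weight (x + d)) (weight (y + d)) ⟩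
    (weight (suc (x + d)) + weight (y + d)) + (weight (x + d) + weight y)
      ≤⟨ +-mono-≤ (weight-convex-suc (+-monoˡ-≤ d x≤y)) (weight-convex d x≤y) ⟩
    (weight (x + d) + weight (suc (y + d))) + (weight x + weight (y + d))
      ≡⟨ lemma₂ (weight (x + d)) (weight (suc (y + d))) (weight x) (weight (y + d)) ⟩
    weight x + weight (suc (y + d)) + (weight (x + d) + weight (y + d))
      ≡⟨ cong (λ z → weight x + weight z + (weight (x + d) + weight (y + d))) (sym (+-suc y d)) ⟩
    weight x + weight (y + suc d) + (weight (x + d) + weight (y + d)) ∎)
    where
    open ≤-Reasoning
    lemma₁ : ∀ a b e g → a + b + (e + g) ≡ (a + g) + (e + b)
    lemma₁ = solve-∀
    lemma₂ : ∀ a b e g → (a + b) + (e + g) ≡ e + b + (a + g)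
    lemma₂ = solve-∀

  weight-superadditive : ∀ x y → weight x + weight y ≤ weight (y + x)
  weight-superadditive x y = weight-convex {0} {y} x z≤n

  -- Since 2t ≤ k - 1, r C(t, r-1) ≤ C(2t, r-1) ≤ C(k-1, r-1), and k C(k-1, r-1) = r C(k, r). The
  -- term t of the cost is compared with C(k, 2) in the same way, with 2 for r. Multiplying by r and
  -- by 2 avoids division.
  cost-total : ∀ {t k} → t + t < k → k * cost t ≤ weight k
  cost-total {t} {suc n} (s≤s 2t≤n) =
    ≤-trans (≤-reflexive (*-distribˡ-⊔ (suc n) (binom t (suc ρ)) t)) (⊔-mono-≤ cliques edges)
    where
    open ≤-Reasoning
    lemma : ∀ a b e → a * (b * e) ≡ b * (a * e)
    lemma = solve-∀
    double : ∀ t → 2 * t ≡ t + t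
    double = solve-∀
    cliques : suc n * binom t (suc ρ) ≤ binom (suc n) r
    cliques = *-cancelˡ-≤ r (begin
      r * (suc n * binom t (suc ρ))      ≡⟨ lemma r (suc n) (binom t (suc ρ)) ⟩
      suc n * (r * binom t (suc ρ))      ≤⟨ *-monoʳ-≤ (suc n) (≤-trans (binom-double t (suc ρ)) (binom-mono (suc ρ) 2t≤n)) ⟩
      suc n * binom n (suc ρ)            ≡⟨ absorption n (suc ρ) ⟨
      r * binom (suc n) r                ∎)
    edges : suc n * t ≤ binom (suc n) 2
    edges = *-cancelˡ-≤ 2 (begin
      2 * (suc n * t)       ≡⟨ lemma 2 (suc n) t ⟩
      suc n * (2 * t)       ≤⟨ *-monoʳ-≤ (suc n) (≤-trans (≤-reflexive (double t)) 2t≤n) ⟩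
      suc n * n             ≡⟨ twice-binom-two n ⟨
      2 * binom (suc n) 2   ∎)

  -- The left half of `weight-tangent`: every increment up to the one from c to c + 1 is at most
  -- `cost c`.
  weight-descend : ∀ c d q → q + d ≡ suc c → weight (suc c) ≤ weight q + d * cost c
  weight-descend c zero q eq = ≤-reflexive (trans (cong weight (sym (trans (sym (+-identityʳ q)) eq))) (sym (+-identityʳ _)))
  weight-descend c (suc d) q eq = begin
    weight (suc c)                       ≤⟨ weight-descend c d (suc q) (trans (sym (+-suc q d)) eq) ⟩
    weight (suc q) + d * cost c          ≤⟨ +-monoˡ-≤ _ (weight-suc≤ q) ⟩
    weight q + cost q + d * cost c       ≤⟨ +-monoˡ-≤ _ (+-monoʳ-≤ (weight q) (cost-mono q≤c)) ⟩
    weight q + cost c + d * cost c       ≡⟨ +-assoc (weight q) _ _ ⟩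
    weight q + suc d * cost c            ∎
    where
    open ≤-Reasoning
    q≤c : q ≤ c
    q≤c = ≤-trans (m≤m+n q d) (≤-reflexive (suc-injective (trans (sym (+-suc q d)) eq)))

  -- The tangent to the convex function weight at c + 1 has slope cost c.
  weight-tangent : ∀ c q → weight (suc c) + q * cost c ≤ weight q + suc c * cost c
  weight-tangent c q with ≤-total (suc c) q
  ... | inj₁ c<q = begin
    weight (suc c) + q * cost c                                     ≡⟨ cong (λ z → weight (suc c) + z * cost c) (sym (m∸n+n≡m c<q)) ⟩
    weight (suc c) + (q ∸ suc c + suc c) * cost c                   ≡⟨ cong (weight (suc c) +_) (*-distribʳ-+ (cost c) (q ∸ suc c) (suc c)) ⟩
    weight (suc c) + ((q ∸ suc c) * cost c + suc c * cost c)        ≡⟨ +-assoc (weight (suc c)) _ _ ⟨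
    weight (suc c) + (q ∸ suc c) * cost c + suc c * cost c          ≤⟨ +-monoˡ-≤ _ (weight-steps (suc c) (q ∸ suc c) ≤-refl) ⟩
    weight (suc c + (q ∸ suc c)) + suc c * cost c                   ≡⟨ cong (λ z → weight z + suc c * cost c) (m+[n∸m]≡n c<q) ⟩
    weight q + suc c * cost c                                       ∎
    where open ≤-Reasoning
  ... | inj₂ q≤c = begin
    weight (suc c) + q * cost c                                ≤⟨ +-monoˡ-≤ _ (weight-descend c (suc c ∸ q) q (m+[n∸m]≡n q≤c)) ⟩
    weight q + (suc c ∸ q) * cost c + q * cost c               ≡⟨ +-assoc (weight q) _ _ ⟩
    weight q + ((suc c ∸ q) * cost c + q * cost c)             ≡⟨ cong (weight q +_) (*-distribʳ-+ (cost c) (suc c ∸ q) q) ⟨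
    weight q + (suc c ∸ q + q) * cost c                        ≡⟨ cong (λ z → weight q + z * cost c) (m∸n+n≡m q≤c) ⟩
    weight q + suc c * cost c                                  ∎
    where open ≤-Reasoning

  -- The final count, with s + c = k: a core on s vertices and c + q cheap vertices weigh no more
  -- than a full block and a rest of size q. Three inequalities are added: `cost-total` for 2c + 1
  -- vertices, convexity shifting c from c + 1 to s, and the tangent at c + 1 evaluated at q. The
  -- auxiliary terms at c + 1 cancel.
  core-plus-sparse : ∀ {s} c q → c < s → weight s + (c + q) * cost c ≤ weight (s + c) + weight q
  core-plus-sparse {s} c q c<s = +-cancelʳ-≤ (weight (suc c) + suc c * cost c) _ _ (begin
    weight s + (c + q) * cost c + (weight (suc c) + suc c * cost c)
      ≡⟨ lemma₁ (weight s) c q (cost c) (weight (suc c)) ⟩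
    (suc c + c) * cost c + weight s + (weight (suc c) + q * cost c)
      ≤⟨ +-mono-≤ (+-monoˡ-≤ (weight s) (cost-total {c} {suc c + c} ≤-refl)) (weight-tangent c q) ⟩
    weight (suc c + c) + weight s + (weight q + suc c * cost c)
      ≤⟨ +-monoˡ-≤ _ (weight-convex c c<s) ⟩
    weight (suc c) + weight (s + c) + (weight q + suc c * cost c)
      ≡⟨ lemma₂ (weight (suc c)) (weight (s + c)) (weight q) (suc c * cost c) ⟩
    weight (s + c) + weight q + (weight (suc c) + suc c * cost c) ∎)
    where
    open ≤-Reasoning
    lemma₁ : ∀ ws c q e wc → ws + (c + q) * e + (wc + suc c * e) ≡ (suc c + c) * e + ws + (wc + q * e)
    lemma₁ = solve-∀
    lemma₂ : ∀ a b e g → a + b + (e + g) ≡ b + e + (a + g)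
    lemma₂ = solve-∀

  -- The bound as a function of n, and its superadditivity

  module Extremal (k : ℕ) .{{_ : NonZero k}} where

    extremal : ℕ → ℕ
    extremal n = (n / k) * weight k + weight (n % k)

    extremal-block : ∀ p {q} → q < k → extremal (p * k + q) ≡ p * weight k + weight q
    extremal-block p {q} q<k = cong₂ (λ a b → a * weight k + weight b) quot rem
      where
      rem : (p * k + q) % k ≡ q
      rem = trans (cong (_% k) (+-comm (p * k) q)) (trans ([m+kn]%n≡m%n q p k) (m<n⇒m%n≡m q<k))
      quot : (p * k + q) / k ≡ p
      quot = trans (+-distrib-/-∣ˡ q (divides-refl p))
        (trans (cong₂ _+_ (m*n/n≡m p k) (m<n⇒m/n≡0 q<k)) (+-identityʳ p))

    extremal-small : ∀ {q} → q < k → extremal q ≡ weight q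
    extremal-small = extremal-block 0

    extremal-+k : ∀ n → extremal (k + n) ≡ weight k + extremal n
    extremal-+k n = begin
      extremal (k + n)                                     ≡⟨ cong extremal k+n≡ ⟩
      extremal (suc (n / k) * k + n % k)                   ≡⟨ extremal-block (suc (n / k)) (m%n<n n k) ⟩
      weight k + (n / k) * weight k + weight (n % k)       ≡⟨ +-assoc (weight k) _ _ ⟩
      weight k + extremal n                                ∎
      where
      open ≡-Reasoning
      k+n≡ : k + n ≡ k + (n / k) * k + n % k
      k+n≡ = trans (cong (k +_) (trans (m≡m%n+[m/n]*n n k) (+-comm (n % k) _))) (sym (+-assoc k _ _))

    weight≤extremal : ∀ {n} → n ≤ k → weight n ≤ extremal n
    weight≤extremal {n} n≤k with m≤n⇒m<n∨m≡n n≤k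
    ... | inj₁ n<k = ≤-reflexive (sym (extremal-small n<k))
    ... | inj₂ refl = ≤-trans (m≤m+n _ _) (≤-reflexive (trans (sym (extremal-+k 0)) (cong extremal (+-identityʳ k))))

    extremal-superadditive : ∀ a b → extremal a + extremal b ≤ extremal (a + b)
    extremal-superadditive a b = subst₂ (λ x y → extremal x + extremal y ≤ extremal (x + y))
      (sym (≡div a)) (sym (≡div b)) (begin
        extremal (a / k * k + a % k) + extremal (b / k * k + b % k)
          ≡⟨ cong₂ _+_ (extremal-block (a / k) (m%n<n a k)) (extremal-block (b / k) (m%n<n b k)) ⟩
        a / k * weight k + weight (a % k) + (b / k * weight k + weight (b % k))
          ≡⟨ lemma₁ (a / k) (b / k) (weight k) (weight (a % k)) (weight (b % k)) ⟩
        (a / k + b / k) * weight k + (weight (a % k) + weight (b % k))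
          ≤⟨ +-monoʳ-≤ ((a / k + b / k) * weight k) (remainders (m%n<n a k) (m%n<n b k)) ⟩
        (a / k + b / k) * weight k + extremal (a % k + b % k)
          ≡⟨ blocks (a / k + b / k) (a % k + b % k) ⟨
        extremal ((a / k + b / k) * k + (a % k + b % k))
          ≡⟨ cong extremal (lemma₁ (a / k) (b / k) k (a % k) (b % k)) ⟨
        extremal (a / k * k + a % k + (b / k * k + b % k)) ∎)
      where
      open ≤-Reasoning
      ≡div : ∀ n → n ≡ n / k * k + n % k
      ≡div n = trans (m≡m%n+[m/n]*n n k) (+-comm (n % k) _)
      lemma₁ : ∀ p q w u v → p * w + u + (q * w + v) ≡ (p + q) * w + (u + v)
      lemma₁ = solve-∀
      blocks : ∀ p n → extremal (p * k + n) ≡ p * weight k + extremal n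
      blocks zero n = refl
      blocks (suc p) n = trans (cong extremal (+-assoc k (p * k) n)) (trans (extremal-+k (p * k + n))
        (trans (cong (weight k +_) (blocks p n)) (sym (+-assoc (weight k) _ _))))
      remainders : ∀ {x y} → x < k → y < k → weight x + weight y ≤ extremal (x + y)
      remainders {x} {y} x<k y<k with x + y <? k
      ... | yes x+y<k = ≤-trans (weight-superadditive x y)
        (≤-reflexive (trans (cong weight (+-comm y x)) (sym (extremal-small x+y<k))))
      -- Convexity pushes the pair (x, y) apart to (z, k) with the same sum; the entry k is then a
      -- full block.
      ... | no x+y≮k = begin
        weight x + weight y                         ≡⟨ cong (λ z → weight z + weight y) x≡ ⟩
        weight (z + (k ∸ y)) + weight y             ≤⟨ weight-convex (k ∸ y) z≤y ⟩
        weight z + weight (y + (k ∸ y))             ≡⟨ cong (λ u → weight z + weight u) (m+[n∸m]≡n (<⇒≤ y<k)) ⟩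
        weight z + weight k                         ≡⟨ +-comm (weight z) _ ⟩
        weight k + weight z                         ≡⟨ cong (weight k +_) (sym (extremal-small (≤-<-trans z≤y y<k))) ⟩
        weight k + extremal z                       ≡⟨ extremal-+k z ⟨
        extremal (k + z)                            ≡⟨ cong extremal k+z≡ ⟩
        extremal (x + y)                            ∎
        where
        z : ℕ
        z = x + y ∸ k
        k+z≡ : k + z ≡ x + y
        k+z≡ = m+[n∸m]≡n (≮⇒≥ x+y≮k)
        z≤y : z ≤ y
        z≤y = +-cancelˡ-≤ k _ _ (≤-trans (≤-reflexive k+z≡) (+-monoˡ-≤ y (<⇒≤ x<k)))
        x≡ : x ≡ z + (k ∸ y)
        x≡ = +-cancelʳ-≡ y _ _ (trans (sym k+z≡) (trans (+-comm k z)
          (trans (cong (z +_) (sym (m∸n+n≡m (<⇒≤ y<k)))) (sym (+-assoc z _ y)))))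

-- Counting cliques in lists of vertices

filterᵇ-all : ∀ {p : A → Bool} {L} → All (λ x → p x ≡ true) L → filterᵇ p L ≡ L
filterᵇ-all [] = refl
filterᵇ-all (e ∷ h) rewrite e = cong (_ ∷_) (filterᵇ-all h)

filterᵇ-none : ∀ {p : A → Bool} {L} → All (λ x → p x ≡ false) L → filterᵇ p L ≡ []
filterᵇ-none [] = refl
filterᵇ-none (e ∷ h) rewrite e = filterᵇ-none h

filterᵇ-cong : ∀ {p q : A → Bool} → (∀ x → p x ≡ q x) → ∀ L → filterᵇ p L ≡ filterᵇ q L
filterᵇ-cong h [] = refl
filterᵇ-cong {q = q} h (x ∷ L) rewrite h x with q x
... | true = cong (x ∷_) (filterᵇ-cong h L)
... | false = filterᵇ-cong h L

filterᵇ-++ : ∀ (p : A → Bool) L M → filterᵇ p (L ++ M) ≡ filterᵇ p L ++ filterᵇ p M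
filterᵇ-++ p [] M = refl
filterᵇ-++ p (x ∷ L) M with p x
... | true = cong (x ∷_) (filterᵇ-++ p L M)
... | false = filterᵇ-++ p L M

filterᵇ-comm : ∀ (p q : A → Bool) L → filterᵇ p (filterᵇ q L) ≡ filterᵇ q (filterᵇ p L)
filterᵇ-comm p q [] = refl
filterᵇ-comm p q (x ∷ L) with p x in ep | q x in eq
... | true | true rewrite ep | eq = cong (x ∷_) (filterᵇ-comm p q L)
... | true | false rewrite eq = filterᵇ-comm p q L
... | false | true rewrite ep = filterᵇ-comm p q L
... | false | false = filterᵇ-comm p q L

filterᵇ-map : ∀ (p : B → Bool) (h : A → B) L → filterᵇ p (map h L) ≡ map h (filterᵇ (p ∘ h) L)
filterᵇ-map p h [] = refl
filterᵇ-map p h (x ∷ L) with p (h x)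
... | true = cong (h x ∷_) (filterᵇ-map p h L)
... | false = filterᵇ-map p h L

length-filterᵇ : ∀ (p : A → Bool) L → length (filterᵇ p L) ≤ length L
length-filterᵇ p [] = z≤n
length-filterᵇ p (x ∷ L) with p x
... | true = s≤s (length-filterᵇ p L)
... | false = m≤n⇒m≤1+n (length-filterᵇ p L)

length-filterᵇ-mono : ∀ {p q : A → Bool} → (∀ x → p x ≡ true → q x ≡ true) →
  ∀ L → length (filterᵇ p L) ≤ length (filterᵇ q L)
length-filterᵇ-mono h [] = z≤n
length-filterᵇ-mono {p = p} {q} h (x ∷ L) with p x in ep | q x in eq
... | true | true = s≤s (length-filterᵇ-mono h L)
... | true | false = contradiction (trans (sym eq) (h x ep)) λ ()
... | false | true = m≤n⇒m≤1+n (length-filterᵇ-mono h L)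
... | false | false = length-filterᵇ-mono h L

-- A list stands for an induced subgraph. Deleting a vertex is taking the tail, so the loss at a
-- deletion is the second summand of the recursion, and `cliques-↭` lets any vertex come first.
cliques : (A → A → Bool) → ℕ → List A → ℕ
cliques E zero L = 1
cliques E (suc r) [] = 0
cliques E (suc r) (x ∷ L) = cliques E (suc r) L + cliques E r (filterᵇ (E x) L)

cliques-one : ∀ (E : A → A → Bool) L → cliques E 1 L ≡ length L
cliques-one E [] = refl
cliques-one E (x ∷ L) = trans (+-comm _ 1) (cong suc (cliques-one E L))

cliques≤binom : ∀ (E : A → A → Bool) r L → cliques E r L ≤ binom (length L) r
cliques≤binom E zero L = ≤-refl
cliques≤binom E (suc r) [] = z≤n
cliques≤binom E (suc r) (x ∷ L) = ≤-trans (≤-reflexive (+-comm (cliques E (suc r) L) _))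
  (+-mono-≤ (≤-trans (cliques≤binom E r _) (binom-mono r (length-filterᵇ (E x) L))) (cliques≤binom E (suc r) L))

cliques-complete : ∀ {E : A → A → Bool} r {L} → AllPairs (λ x y → E x y ≡ true) L →
  cliques E r L ≡ binom (length L) r
cliques-complete zero h = refl
cliques-complete (suc r) [] = refl
cliques-complete {E = E} (suc r) {x ∷ L} (e ∷ h) rewrite filterᵇ-all {p = E x} e =
  trans (+-comm (cliques E (suc r) L) _) (cong₂ _+_ (cliques-complete r h) (cliques-complete (suc r) h))

cliques-edgeless : ∀ {E : A → A → Bool} r {L} → AllPairs (λ x y → E x y ≡ false) L →
  cliques E (2 + r) L ≡ 0
cliques-edgeless r [] = refl
cliques-edgeless {E = E} r {x ∷ L} (e ∷ h) rewrite filterᵇ-none {p = E x} e =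
  trans (+-identityʳ _) (cliques-edgeless r h)

-- The size is positive because the empty clique lies in both parts and would be counted twice on
-- the right.
cliques-++ : ∀ {E : A → A → Bool} r L {M} → All (λ x → All (λ y → E x y ≡ false) M) L →
  cliques E (suc r) (L ++ M) ≡ cliques E (suc r) L + cliques E (suc r) M
cliques-++ r [] h = refl
cliques-++ {E = E} r (x ∷ L) {M} (e ∷ h) = begin
  cliques E (suc r) (L ++ M) + cliques E r (filterᵇ (E x) (L ++ M))
    ≡⟨ cong₂ (λ u v → u + cliques E r v) (cliques-++ r L h)
         (trans (filterᵇ-++ (E x) L M) (trans (cong (filterᵇ (E x) L ++_) (filterᵇ-none e)) (++-identityʳ _))) ⟩
  cliques E (suc r) L + cliques E (suc r) M + cliques E r (filterᵇ (E x) L)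
    ≡⟨ lemma (cliques E (suc r) L) (cliques E (suc r) M) (cliques E r (filterᵇ (E x) L)) ⟩
  cliques E (suc r) L + cliques E r (filterᵇ (E x) L) + cliques E (suc r) M ∎
  where
  open ≡-Reasoning
  lemma : ∀ a b c → a + b + c ≡ a + c + b
  lemma = solve-∀

cliques-map : ∀ {E : B → B → Bool} (h : A → B) r L →
  cliques E r (map h L) ≡ cliques (λ x y → E (h x) (h y)) r L
cliques-map h zero L = refl
cliques-map h (suc r) [] = refl
cliques-map {E = E} h (suc r) (x ∷ L) = cong₂ _+_ (cliques-map h (suc r) L)
  (trans (cong (cliques E r) (filterᵇ-map (E (h x)) h L)) (cliques-map h r _))

cliques-cong : ∀ {E F : A → A → Bool} → (∀ x y → E x y ≡ F x y) → ∀ r L → cliques E r L ≡ cliques F r L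
cliques-cong h zero L = refl
cliques-cong h (suc r) [] = refl
cliques-cong {E = E} {F} h (suc r) (x ∷ L) = cong₂ _+_ (cliques-cong h (suc r) L)
  (trans (cliques-cong h r _) (cong (cliques F r) (filterᵇ-cong (h x) L)))

edges-mono : ∀ {E F : A → A → Bool} → (∀ x y → E x y ≡ true → F x y ≡ true) →
  ∀ L → cliques E 2 L ≤ cliques F 2 L
edges-mono h [] = z≤n
edges-mono {E = E} {F} h (x ∷ L) = +-mono-≤ (edges-mono h L)
  (subst₂ _≤_ (sym (cliques-one E (filterᵇ (E x) L))) (sym (cliques-one F (filterᵇ (F x) L))) (length-filterᵇ-mono (h x) L))

-- Cliques through both x and y live in the common neighbourhood, which does not depend on the order
-- of the two filters.
cliques-swap : ∀ {E : A → A → Bool} → (∀ x y → E x y ≡ E y x) → ∀ r x y L →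
  cliques E (suc r) (x ∷ y ∷ L) ≡ cliques E (suc r) (y ∷ x ∷ L)
cliques-swap {E = E} E-sym r x y L rewrite E-sym y x with E x y
... | false = swapʳ (cliques E (suc r) L) _ _
  where
  swapʳ : ∀ a b c → a + b + c ≡ a + c + b
  swapʳ = solve-∀
... | true with r
...   | zero = refl
...   | suc r rewrite filterᵇ-comm (E x) (E y) L =
    lemma (cliques E (2 + r) L) (cliques E (suc r) (filterᵇ (E y) L)) (cliques E (suc r) (filterᵇ (E x) L)) _
  where
  lemma : ∀ a b c d → a + b + (c + d) ≡ a + c + (b + d)
  lemma = solve-∀

cliques-↭ : ∀ {E : A → A → Bool} → (∀ x y → E x y ≡ E y x) → ∀ r {L M} → L ↭ M →
  cliques E r L ≡ cliques E r M
cliques-↭ E-sym zero p = refl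
cliques-↭ E-sym (suc r) ↭refl = refl
cliques-↭ {E = E} E-sym (suc r) (↭prep x p) =
  cong₂ _+_ (cliques-↭ E-sym (suc r) p) (cliques-↭ E-sym r (filter-↭ (T? ∘ E x) p))
cliques-↭ {E = E} E-sym (suc r) {x ∷ y ∷ L} (↭swap x y p) = trans (cliques-swap E-sym r x y L)
  (cong₂ _+_ (cong₂ _+_ (cliques-↭ E-sym (suc r) p) (cliques-↭ E-sym r (filter-↭ (T? ∘ E x) p)))
    (cliques-↭ E-sym r (filter-↭ (T? ∘ E y) (↭prep x p))))
cliques-↭ E-sym (suc r) (↭trans p q) = trans (cliques-↭ E-sym (suc r) p) (cliques-↭ E-sym (suc r) q)

-- Provides the vertex to delete in `total≤weight`: an end of an edge is moved to the front, so that
-- its other end is counted behind it.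
find-edge : ∀ (E : A → A → Bool) L → cliques E 2 L ≢ 0 →
  ∃ λ x → ∃ λ M → L ↭ x ∷ M × 1 ≤ length (filterᵇ (E x) M)
find-edge E [] h = contradiction refl h
find-edge E (y ∷ L) h with filterᵇ (E y) L in eq
... | z ∷ zs = y , L , ↭refl , ≤-trans (s≤s z≤n) (≤-reflexive (cong length (sym eq)))
... | [] with find-edge E L (λ e → h (trans (+-identityʳ _) e))
...   | x , M , p , q = x , y ∷ M , ↭trans (↭prep y p) (↭swap y x ↭refl) , ≤-trans q grow
  where
  grow : length (filterᵇ (E x) M) ≤ length (filterᵇ (E x) (y ∷ M))
  grow with E x y
  ... | true = n≤1+n _
  ... | false = ≤-refl

-- Red-blue weights and the loss at a deleted vertex

isEdge : Col → Bool
isEdge none = false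
isEdge red = true
isEdge blue = true

module Coloured (colour : A → A → Col) where

  blueE redE adj : A → A → Bool
  blueE x y = isBlue (colour x y)
  redE x y = isRed (colour x y)
  adj x y = isEdge (colour x y)

  degree : A → List A → ℕ
  degree x L = length (filterᵇ (adj x) L)

  total : ℕ → List A → ℕ
  total r L = cliques blueE r L + cliques redE 2 L

  degree-split : ∀ x L → length (filterᵇ (blueE x) L) + length (filterᵇ (redE x) L) ≡ degree x L
  degree-split x [] = refl
  degree-split x (y ∷ L) with colour x y
  ... | none = degree-split x L
  ... | red = trans (+-suc _ _) (cong suc (degree-split x L))
  ... | blue = cong suc (degree-split x L)

  total-++ : ∀ r L {M} → All (λ x → All (λ y → adj x y ≡ false) M) L →
    total (suc r) (L ++ M) ≡ total (suc r) L + total (suc r) M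
  total-++ r L {M} h = trans
    (cong₂ _+_ (cliques-++ r L (All.map (All.map (notBlue _ _)) h)) (cliques-++ 1 L (All.map (All.map (notRed _ _)) h)))
    (lemma (cliques blueE (suc r) L) _ (cliques redE 2 L) _)
    where
    lemma : ∀ a b c d → (a + b) + (c + d) ≡ (a + c) + (b + d)
    lemma = solve-∀
    notBlue : ∀ x y → adj x y ≡ false → blueE x y ≡ false
    notBlue x y with colour x y
    ... | none = λ _ → refl
    ... | red = λ _ → refl
    ... | blue = λ ()
    notRed : ∀ x y → adj x y ≡ false → redE x y ≡ false
    notRed x y with colour x y
    ... | none = λ _ → refl
    ... | red = λ ()
    ... | blue = λ _ → refl

  module _ (ρ : ℕ) where
    open Weights ρ

    -- A blue K_r through x is x with r - 1 of its blue neighbours, and every such choice is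
    -- conceded; the red edges at x are counted exactly.
    total-∷ : ∀ x L →
      total r (x ∷ L) ≤ total r L + (binom (length (filterᵇ (blueE x) L)) (suc ρ) + length (filterᵇ (redE x) L))
    total-∷ x L = begin
      (a + b) + (c + d)     ≡⟨ lemma a b c d ⟩
      (a + c) + (b + d)     ≤⟨ +-monoʳ-≤ (a + c) (+-mono-≤ (cliques≤binom blueE (suc ρ) (filterᵇ (blueE x) L))
                                 (≤-reflexive (cliques-one redE (filterᵇ (redE x) L)))) ⟩
      total r L + (binom (length (filterᵇ (blueE x) L)) (suc ρ) + length (filterᵇ (redE x) L)) ∎
      where
      open ≤-Reasoning
      a b c d : ℕ
      a = cliques blueE r L
      b = cliques blueE (suc ρ) (filterᵇ (blueE x) L)
      c = cliques redE 2 L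
      d = cliques redE 1 (filterᵇ (redE x) L)
      lemma : ∀ a b c d → (a + b) + (c + d) ≡ (a + c) + (b + d)
      lemma = solve-∀

    total-cost : ∀ {x d} L → degree x L ≤ d → total r (x ∷ L) ≤ total r L + cost d
    total-cost {x} L h = ≤-trans (total-∷ x L) (+-monoʳ-≤ (total r L)
      (≤-trans (split-cost (length (filterᵇ (blueE x) L)) (length (filterᵇ (redE x) L)))
        (cost-mono (≤-trans (≤-reflexive (degree-split x L)) h))))

  module Symmetric (colour-sym : ∀ x y → colour x y ≡ colour y x) where

    total-↭ : ∀ r {L M} → L ↭ M → total r L ≡ total r M
    total-↭ r p = cong₂ _+_ (cliques-↭ (λ x y → cong isBlue (colour-sym x y)) r p)
                            (cliques-↭ (λ x y → cong isRed (colour-sym x y)) 2 p)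

    module _ (ρ : ℕ) where
      open Weights ρ

      -- Deleting an arbitrary vertex suffices except from r + 2 to r + 1 vertices (see weight-step);
      -- there, unless all edges are blue, a vertex on a red edge has blue degree at most r.
      total≤weight : ∀ n L → length L ≡ n → total r L ≤ weight n
      total≤weight zero [] refl = z≤n
      total≤weight (suc i) L@(x ∷ M) len with i ≟ suc r
      ... | no i≢1+r = begin
        total r (x ∷ M)        ≤⟨ total-cost ρ M (≤-trans (length-filterᵇ _ M) (≤-reflexive (suc-injective len))) ⟩
        total r M + cost i     ≤⟨ +-monoˡ-≤ (cost i) (total≤weight i M (suc-injective len)) ⟩
        weight i + cost i      ≤⟨ weight-step (inj₂ (≤-refl , i≢1+r)) ⟩
        weight (suc i)         ∎
        where open ≤-Reasoning
      ... | yes i≡1+r with cliques redE 2 L ≟ 0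
      ...   | yes redless = begin
        cliques blueE r L + cliques redE 2 L   ≡⟨ cong (cliques blueE r L +_) redless ⟩
        cliques blueE r L + 0                  ≡⟨ +-identityʳ _ ⟩
        cliques blueE r L                      ≤⟨ cliques≤binom blueE r L ⟩
        binom (length L) r                     ≡⟨ cong (λ n → binom n r) len ⟩
        binom (suc i) r                        ≤⟨ m≤m⊔n _ _ ⟩
        weight (suc i)                         ∎
        where open ≤-Reasoning
      ...   | no ¬redless with find-edge redE L ¬redless
      ...     | z , N , p , 1≤red = begin
        total r L                              ≡⟨ total-↭ r p ⟩
        total r (z ∷ N)                        ≤⟨ total-∷ ρ z N ⟩
        total r N + (binom b (suc ρ) + e)      ≤⟨ +-mono-≤ (total≤weight i N lenN) (≤-trans (+-monoˡ-≤ e (binom≤n (s≤s z≤n) b≤r)) b+e≤) ⟩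
        weight i + i                           ≡⟨ cong (_+ i) (weight-small (s≤s (≤-reflexive i≡1+r))) ⟩
        binom i 2 + i                          ≡⟨ +-comm (binom i 2) i ⟩
        i + binom i 2                          ≡⟨ binom-suc-two i ⟨
        binom (suc i) 2                        ≤⟨ m≤n⊔m _ _ ⟩
        weight (suc i)                         ∎
        where
        open ≤-Reasoning
        b e : ℕ
        b = length (filterᵇ (blueE z) N)
        e = length (filterᵇ (redE z) N)
        lenN : length N ≡ i
        lenN = suc-injective (trans (sym (↭-length p)) len)
        b+e≤ : b + e ≤ i
        b+e≤ = ≤-trans (≤-reflexive (degree-split z N)) (≤-trans (length-filterᵇ _ N) (≤-reflexive lenN))
        b≤r : b ≤ r
        b≤r = ≤-pred (≤-trans (≤-reflexive (+-comm 1 b)) (≤-trans (+-monoʳ-≤ b 1≤red) (≤-trans b+e≤ (≤-reflexive i≡1+r))))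

-- Lists without repetition and counting by inclusion

AllPairs-resp-↭ : ∀ {R : A → A → Set} → (∀ {x y} → R x y → R y x) → ∀ {L M} → L ↭ M → AllPairs R L → AllPairs R M
AllPairs-resp-↭ R-sym ↭refl h = h
AllPairs-resp-↭ R-sym (↭prep x p) (hx ∷ h) = All-resp-↭ p hx ∷ AllPairs-resp-↭ R-sym p h
AllPairs-resp-↭ R-sym (↭swap x y p) ((hxy ∷ hx) ∷ hy ∷ h) =
  (R-sym hxy ∷ All-resp-↭ p hy) ∷ All-resp-↭ p hx ∷ AllPairs-resp-↭ R-sym p h
AllPairs-resp-↭ R-sym (↭trans p q) h = AllPairs-resp-↭ R-sym q (AllPairs-resp-↭ R-sym p h)

Unique-resp-↭ : ∀ {L M : List A} → L ↭ M → Unique L → Unique M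
Unique-resp-↭ = AllPairs-resp-↭ (_∘ sym)

∈⇒↭ : ∀ {x : A} {L} → x ∈ L → ∃ λ M → L ↭ x ∷ M
∈⇒↭ {x = x} h with ys , zs , refl ← ∈-∃++ h = ys ++ zs , shift x ys zs

unique-⊆-length : ∀ {L M : List A} → Unique L → (∀ {v} → v ∈ L → v ∈ M) → length L ≤ length M
unique-⊆-length [] sub = z≤n
unique-⊆-length {L = x ∷ L} {M} (x∉L ∷ u) sub with N , p ← ∈⇒↭ (sub (here refl)) =
  ≤-trans (s≤s (unique-⊆-length u sub′)) (≤-reflexive (sym (↭-length p)))
  where
  sub′ : ∀ {v} → v ∈ L → v ∈ N
  sub′ {v} v∈L with ∈-resp-↭ p (sub (there v∈L))
  ... | here refl = contradiction refl (All.lookup x∉L v∈L)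
  ... | there q = q

∧-true : ∀ {a b} → a ∧ b ≡ true → a ≡ true × b ≡ true
∧-true {true} h = refl , h

T⇒≡ : ∀ {b} → T b → b ≡ true
T⇒≡ {true} _ = refl

≡⇒T : ∀ {b} → b ≡ true → T b
≡⇒T refl = _

∈-filterᵇ⁺ : ∀ {p : A → Bool} {v L} → v ∈ L → p v ≡ true → v ∈ filterᵇ p L
∈-filterᵇ⁺ {p = p} v∈L e = ∈-filter⁺ (T? ∘ p) v∈L (≡⇒T e)

∈-filterᵇ⁻ : ∀ {p : A → Bool} {v} L → v ∈ filterᵇ p L → v ∈ L × p v ≡ true
∈-filterᵇ⁻ {p = p} L h with a , b ← ∈-filter⁻ (T? ∘ p) {xs = L} h = a , T⇒≡ b

count-⊆ : ∀ {p q : A → Bool} {L M} → Unique L → (∀ {v} → v ∈ L → p v ≡ true → v ∈ M × q v ≡ true) →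
  length (filterᵇ p L) ≤ length (filterᵇ q M)
count-⊆ {p = p} {q} {L} {M} u sub = unique-⊆-length {M = filterᵇ q M} (Unique-filter⁺ (T? ∘ p) u) λ h →
  let a , b = ∈-filterᵇ⁻ L h ; c , d = sub a b in ∈-filterᵇ⁺ c d

-- Replace each X-entry of ws by its predecessor. The predecessors avoid the Y-entries by the first
-- condition, and by the second the last position is free of both; all other positions number
-- `length ws`.
count-crossing : ∀ (X Y : A → Bool) w ws →
  (∀ as u v bs → w ∷ ws ≡ as ++ u ∷ v ∷ bs → Y u ≡ true → X v ≡ true → ⊥) →
  (∀ as u → w ∷ ws ≡ as ∷ʳ u → Y u ≡ true → ⊥) →
  length (filterᵇ X ws) + length (filterᵇ Y (w ∷ ws)) ≤ length ws
count-crossing X Y w [] cross end with Y w in ey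
... | true = ⊥-elim (end [] w refl ey)
... | false = z≤n
count-crossing X Y w (v ∷ ws) cross end
  with ih ← count-crossing X Y v ws (λ as a b bs e → cross (w ∷ as) a b bs (cong (w ∷_) e))
                                    (λ as a e → end (w ∷ as) a (cong (w ∷_) e))
  with X v in ex | Y w in ey
... | true | true = ⊥-elim (cross [] w v ws refl ey ex)
... | true | false = s≤s ih
... | false | true = ≤-trans (≤-reflexive (+-suc _ _)) (s≤s ih)
... | false | false = m≤n⇒m≤1+n ih

-- Paths as chains; reversal and rotation

module Paths {V : Set} (_≟ᵛ_ : DecidableEquality V) (adj : V → V → Bool)
  (adj-sym : ∀ x y → adj x y ≡ adj y x) (adj-irrefl : ∀ x → adj x x ≡ false) where

  open DecMembership _≟ᵛ_ using (_∈?_)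

  Chain : List V → Set
  Chain = Linked (λ x y → adj x y ≡ true)

  flip : ∀ {x y} → adj x y ≡ true → adj y x ≡ true
  flip e = trans (adj-sym _ _) e

  headOr : V → List V → V
  headOr u [] = u
  headOr u (a ∷ _) = a

  chain-join : ∀ {x} as {y bs} → Chain (x ∷ as) → Chain (y ∷ bs) → adj x y ≡ true →
    Chain ((x ∷ as) ʳ++ (y ∷ bs))
  chain-join [] ca cb e = e ∷ cb
  chain-join (a ∷ as) (e′ ∷ ca) cb e = chain-join as ca (e ∷ cb) (flip e′)

  -- Walking back from u ends at the first vertex of the path, which is `headOr u as` and hence u
  -- itself when as is empty; from there the edge to z is taken. A chord at the first vertex thus
  -- gives a new path on the same vertices.
  chain-reverse-onto : ∀ as {u z bs} → Chain (as ∷ʳ u) → Chain (z ∷ bs) → adj (headOr u as) z ≡ true →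
    Chain (u ∷ (as ʳ++ (z ∷ bs)))
  chain-reverse-onto [] ca cb e = e ∷ cb
  chain-reverse-onto (x ∷ []) (e′ ∷ ca) cb e = chain-reverse-onto [] ca (e ∷ cb) (flip e′)
  chain-reverse-onto (x ∷ x′ ∷ as) (e′ ∷ ca) cb e = chain-reverse-onto (x′ ∷ as) ca (e ∷ cb) (flip e′)

  chain-reverse : ∀ as {u} → Chain (as ∷ʳ u) → Chain (u ∷ (as ʳ++ []))
  chain-reverse [] ca = [-]
  chain-reverse (x ∷ []) (e ∷ ca) = flip e ∷ [-]
  chain-reverse (x ∷ x′ ∷ as) (e ∷ ca) = chain-reverse-onto (x′ ∷ as) ca [-] (flip e)

  chain-++⁻ˡ : ∀ as {bs} → Chain (as ++ bs) → Chain as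
  chain-++⁻ˡ [] c = []
  chain-++⁻ˡ (a ∷ []) c = [-]
  chain-++⁻ˡ (a ∷ a′ ∷ as) (e ∷ c) = e ∷ chain-++⁻ˡ (a′ ∷ as) c

  chain-++⁻ʳ : ∀ as {bs} → Chain (as ++ bs) → Chain bs
  chain-++⁻ʳ [] c = c
  chain-++⁻ʳ (a ∷ []) [-] = []
  chain-++⁻ʳ (a ∷ []) (e ∷ c) = c
  chain-++⁻ʳ (a ∷ a′ ∷ as) (e ∷ c) = chain-++⁻ʳ (a′ ∷ as) c

  reverse-↭ : ∀ (as : List V) u bs → u ∷ (as ʳ++ bs) ↭ as ++ u ∷ bs
  reverse-↭ as u bs = ↭-trans (↭prep u (↭-sym (++↭ʳ++ as bs))) (↭-sym (shift u as bs))

  -- The edge between x and z closes the path to a cycle. Opened at b, it runs from b back to x,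
  -- over to z, and back to the successor of b.
  rotate : ∀ {x as} zs z → Chain (x ∷ as) → x ∷ as ≡ zs ∷ʳ z → adj x z ≡ true → ∀ {b} → b ∈ x ∷ as →
    ∃ λ Q → Chain (b ∷ Q) × (b ∷ Q ↭ x ∷ as)
  rotate {x} {as} zs z c eq e {b} b∈ with ∈-∃++ b∈
  ... | ys , ws , eq′ with initLast ws
  ...   | [] = ys ʳ++ [] , chain-reverse ys (subst Chain eq′ c) , ↭-trans (reverse-↭ ys b []) (↭-reflexive (sym eq′))
  ...   | ws′ ∷ʳ′ w = ys ʳ++ (w ∷ (ws′ ʳ++ [])) ,
          chain-reverse-onto ys (chain-++⁻ˡ (ys ∷ʳ b) c₁) (chain-reverse ws′ (chain-++⁻ʳ (ys ∷ʳ b) c₁)) e′ ,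
          ↭-trans (reverse-↭ ys b _) (↭-trans (++⁺ˡ ys (↭prep b (reverse-↭ ws′ w []))) (↭-reflexive (sym eq′)))
    where
    c₁ : Chain ((ys ∷ʳ b) ++ (ws′ ∷ʳ w))
    c₁ = subst Chain (trans eq′ (sym (++-assoc ys (b ∷ []) _))) c
    w≡z : w ≡ z
    w≡z = ∷ʳ-injectiveʳ (ys ++ b ∷ ws′) zs (trans (++-assoc ys (b ∷ ws′) (w ∷ [])) (trans (sym eq′) eq))
    x≡ : ∀ ys {ws} → x ∷ as ≡ ys ++ b ∷ ws → headOr b ys ≡ x
    x≡ [] refl = refl
    x≡ (y ∷ ys) refl = refl
    e′ : adj (headOr b ys) w ≡ true
    e′ = trans (cong₂ adj (x≡ ys eq′) w≡z) e

  Inside : List V → List V → Set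
  Inside L P = Unique P × (∀ {v} → v ∈ P → v ∈ L)

  inside-↭ : ∀ {L P Q} → P ↭ Q → Inside L P → Inside L Q
  inside-↭ p (u , s) = Unique-resp-↭ p u , s ∘ ∈-resp-↭ (↭-sym p)

  LongPathFree : ℕ → List V → Set
  LongPathFree k L = ∀ P → Chain P → Inside L P → ¬ (k < length P)

  -- No cut is free of edges; a and b witness that R is nonempty and proper. In this form
  -- connectedness hands out the next edge leaving R in `no-two-cycles`, and its failure splits the
  -- graph for the induction.
  Connected : List V → Set
  Connected L = ∀ R {a b} → a ∈ R → (∀ {v} → v ∈ R → v ∈ L) → b ∈ L → b ∉ R →
    ∃ λ u → ∃ λ w → u ∈ R × w ∈ L × w ∉ R × adj u w ≡ true

  unique-++⁻ : ∀ (as : List V) {bs} → Unique (as ++ bs) → Unique as × Unique bs × (∀ {v} → v ∈ as → v ∉ bs)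
  unique-++⁻ [] u = [] , u , λ ()
  unique-++⁻ (a ∷ as) {bs} (a∉ ∷ u) with ua , ub , d ← unique-++⁻ as u =
    All.tabulate (λ h → All.lookup a∉ (∈-++⁺ˡ h)) ∷ ua , ub ,
    λ { (here refl) h → All.lookup a∉ (∈-++⁺ʳ as h) refl ; (there q) h → d q h }

  -- Disjoint pairs of paths on more than k vertices

  module Host (L : List V) (k : ℕ) (uniqueL : Unique L)
    (pathFree : LongPathFree k L) (connected : Connected L) where

    no-join : ∀ {x as y bs} → Chain (x ∷ as) → Chain (y ∷ bs) → Inside L ((x ∷ as) ++ (y ∷ bs)) →
      k < length ((x ∷ as) ++ (y ∷ bs)) → adj x y ≡ true → ⊥
    no-join {x} {as} {y} {bs} ca cb ins long e =
      pathFree _ (chain-join as ca cb e) (inside-↭ p ins) (subst (k <_) (↭-length p) long)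
      where p = ++↭ʳ++ (x ∷ as) (y ∷ bs)

    record Pair (x : V) (as : List V) (y : V) (bs : List V) : Set where
      field
        chainˡ : Chain (x ∷ as)
        chainʳ : Chain (y ∷ bs)
        inside : Inside L ((x ∷ as) ++ (y ∷ bs))
        long   : k < length ((x ∷ as) ++ (y ∷ bs))
    open Pair

    swapPair : ∀ {x as y bs} → Pair x as y bs → Pair y bs x as
    swapPair {x} {as} {y} {bs} p = record
      { chainˡ = chainʳ p ; chainʳ = chainˡ p ; inside = inside-↭ q (inside p) ; long = subst (k <_) (↭-length q) (long p) }
      where q = ↭-++-comm (x ∷ as) (y ∷ bs)

    pair-length : ∀ {x as y bs} → Pair x as y bs → length bs < k
    pair-length {x} {as} {y} {bs} p = ≰⇒> λ h →
      pathFree (y ∷ bs) (chainʳ p)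
        (proj₁ (proj₂ (unique-++⁻ (x ∷ as) (proj₁ (inside p)))) , λ v → proj₂ (inside p) (∈-++⁺ʳ (x ∷ as) v)) (s≤s h)

    -- From u back to x, along the chord to v and on to the far end is a path on the same vertices
    -- as the first one. It starts at u, so the edge between y and u joins it to the second path.
    no-crossing : ∀ {x as y bs} → Pair x as y bs → ∀ ps u v qs → x ∷ as ≡ ps ++ u ∷ v ∷ qs →
      adj y u ≡ true → adj x v ≡ true → ⊥
    no-crossing {x} {as} {y} {bs} p ps u v qs eq eu ev =
      no-join (chainʳ p) turned (inside-↭ perm (inside p)) (subst (k <_) (↭-length perm) (long p)) eu
      where
      c : Chain ((ps ∷ʳ u) ++ v ∷ qs)
      c = subst Chain (trans eq (sym (++-assoc ps (u ∷ []) (v ∷ qs)))) (chainˡ p)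
      head≡ : ∀ ps → x ∷ as ≡ ps ++ u ∷ v ∷ qs → headOr u ps ≡ x
      head≡ [] refl = refl
      head≡ (_ ∷ _) refl = refl
      turned : Chain (u ∷ (ps ʳ++ (v ∷ qs)))
      turned = chain-reverse-onto ps (chain-++⁻ˡ (ps ∷ʳ u) c) (chain-++⁻ʳ (ps ∷ʳ u) c)
        (trans (cong (λ z → adj z v) (head≡ ps eq)) ev)
      perm : (x ∷ as) ++ (y ∷ bs) ↭ (y ∷ bs) ++ (u ∷ (ps ʳ++ (v ∷ qs)))
      perm = ↭-trans (↭-++-comm (x ∷ as) (y ∷ bs))
        (++⁺ˡ (y ∷ bs) (↭-trans (↭-reflexive eq) (↭-sym (reverse-↭ ps u (v ∷ qs)))))

    no-far-end : ∀ {x as y bs} → Pair x as y bs → ∀ ps u → x ∷ as ≡ ps ∷ʳ u → adj y u ≡ true → ⊥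
    no-far-end {x} {as} {y} {bs} p ps u eq eu =
      no-join (chainʳ p) (chain-reverse ps (subst Chain eq (chainˡ p)))
        (inside-↭ perm (inside p)) (subst (k <_) (↭-length perm) (long p)) eu
      where
      perm : (x ∷ as) ++ (y ∷ bs) ↭ (y ∷ bs) ++ (u ∷ (ps ʳ++ []))
      perm = ↭-trans (↭-++-comm (x ∷ as) (y ∷ bs))
        (++⁺ˡ (y ∷ bs) (↭-trans (↭-reflexive eq) (↭-sym (reverse-↭ ps u []))))

    -- R collects vertices from which a path inside R of length at least ∣x ∷ as∣ starts;
    -- it grows along crossing edges until it meets the second cycle.
    no-two-cycles : ∀ {x as y bs} → Pair x as y bs →
      ∀ ps u → x ∷ as ≡ ps ∷ʳ u → adj x u ≡ true → ∀ qs v → y ∷ bs ≡ qs ∷ʳ v → adj y v ≡ true → ⊥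
    no-two-cycles {x} {as} {y} {bs} p ps u eqᵃ eᵃ qs v eqᵇ eᵇ =
      grow (suc (length L)) (x ∷ as) (here refl) uniqueᵃ (proj₂ (inside p) ∘ ∈-++⁺ˡ) apart start (s≤s (m≤m+n _ _))
      where
      parts = unique-++⁻ (x ∷ as) (proj₁ (inside p))
      uniqueᵃ = proj₁ parts
      uniqueᵇ = proj₁ (proj₂ parts)
      apart : ∀ {w} → w ∈ x ∷ as → w ∉ y ∷ bs
      apart = proj₂ (proj₂ parts)
      Reaches : List V → V → Set
      Reaches R w = ∃ λ Q → Chain (w ∷ Q) × Unique (w ∷ Q) × (∀ {z} → z ∈ w ∷ Q → z ∈ R) × length (x ∷ as) ≤ length (w ∷ Q)
      start : ∀ {w} → w ∈ x ∷ as → Reaches (x ∷ as) w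
      start w∈ with Q , c , q ← rotate ps u (chainˡ p) eqᵃ eᵃ w∈ =
        Q , c , Unique-resp-↭ (↭-sym q) uniqueᵃ , ∈-resp-↭ q , ≤-reflexive (sym (↭-length q))
      grow : ∀ fuel R → x ∈ R → Unique R → (∀ {w} → w ∈ R → w ∈ L) → (∀ {w} → w ∈ R → w ∉ y ∷ bs) →
        (∀ {w} → w ∈ R → Reaches R w) → length L < fuel + length R → ⊥
      -- R gains a vertex of L in each round and has no repetitions, so the fuel cannot run out.
      grow zero R x∈R uR sub dis reach enough = <⇒≱ enough (unique-⊆-length uR sub)
      grow (suc fuel) R x∈R uR sub dis reach enough
        with connected R x∈R sub (proj₂ (inside p) (∈-++⁺ʳ (x ∷ as) (here refl))) (λ h → dis h (here refl))
      ... | a , w , a∈R , w∈L , w∉R , e with reach a∈R | w ∈? (y ∷ bs)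
      -- The path from a inside R is at least as long as the first path, and the second cycle opened
      -- at w loses no vertex, so joining them along the edge between a and w is too long.
      ...   | Q , c , uQ , QR , len | yes w∈ys with S , cS , q ← rotate qs v (chainʳ p) eqᵇ eᵇ w∈ys =
        no-join c cS (Unique-++⁺ uQ (Unique-resp-↭ (↭-sym q) uniqueᵇ) (λ (h₁ , h₂) → dis (QR h₁) (∈-resp-↭ q h₂)) , subQS)
          (≤-trans (long p) (≤-trans (≤-reflexive (length-++ (x ∷ as)))
            (≤-trans (+-mono-≤ len (≤-reflexive (sym (↭-length q)))) (≤-reflexive (sym (length-++ (a ∷ Q)))))) ) e
        where
        subQS : ∀ {z} → z ∈ (a ∷ Q) ++ (w ∷ S) → z ∈ L
        subQS h with ∈-++⁻ (a ∷ Q) h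
        ... | inj₁ h′ = sub (QR h′)
        ... | inj₂ h′ = proj₂ (inside p) (∈-++⁺ʳ (x ∷ as) (∈-resp-↭ q h′))
      ...   | Q , c , uQ , QR , len | no w∉ys = grow fuel (w ∷ R) (there x∈R)
        (All.tabulate (λ h eq → w∉R (subst (_∈ R) (sym eq) h)) ∷ uR)
        (λ { (here refl) → w∈L ; (there h) → sub h })
        (λ { (here refl) → w∉ys ; (there h) → dis h })
        (λ { (here refl) → a ∷ Q , flip e ∷ c , All.tabulate (λ h eq → w∉R (subst (_∈ R) (sym eq) (QR h))) ∷ uQ ,
               (λ { (here refl) → here refl ; (there h) → there (QR h) }) , m≤n⇒m≤1+n len
           ; (there h) → let Q′ , c′ , u′ , s′ , l′ = reach h in Q′ , c′ , u′ , there ∘ s′ , l′ })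
        (subst (length L <_) (sym (+-suc fuel (length R))) enough)

    count : (V → Bool) → List V → ℕ
    count X M = length (filterᵇ X M)

    count-++ : ∀ X as bs → count X (as ++ bs) ≡ count X as + count X bs
    count-++ X as bs = trans (cong length (filterᵇ-++ X as bs)) (length-++ (filterᵇ X as))

    -- Ore's crossing argument, after trimming the far ends of both paths to reach exactly k + 1 vertices;
    -- trimming is impossible only if both paths close up to cycles.
    endpoint-degrees : ∀ fuel {x as y bs} (X Y : V → Bool) →
      (∀ v → X v ≡ true → adj x v ≡ true) → (∀ v → Y v ≡ true → adj y v ≡ true) →
      Pair x as y bs → length as + length bs < fuel →
      (∀ {v} → v ∈ L → X v ≡ true → v ∈ (x ∷ as) ++ (y ∷ bs)) →
      (∀ {v} → v ∈ L → Y v ≡ true → v ∈ (x ∷ as) ++ (y ∷ bs)) →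
      ¬ (k ≤ count X L + count Y L)
    endpoint-degrees (suc fuel) {x} {as} {y} {bs} X Y X⊆ Y⊆ p (s≤s enough) inX inY deg = trim (initLast as) (initLast bs)
      where
      open ≤-Reasoning
      dropHead : ∀ {z} (Z : V → Bool) → (∀ v → Z v ≡ true → adj z v ≡ true) → ∀ zs → count Z (z ∷ zs) ≡ count Z zs
      dropHead {z} Z Z⊆ zs with Z z in eq
      ... | false = refl
      ... | true = contradiction (trans (sym (Z⊆ z eq)) (adj-irrefl z)) λ ()
      regroup : ∀ a b c d → a + b + (c + d) ≡ (a + c) + (d + b)
      regroup = solve-∀
      -- The hypothesis `long` alone gives only k - 1 here. The unit gained by the crossing counts
      -- is what allows a far end to be dropped while more than k vertices remain.
      excess : k ≤ length as + length bs
      excess = begin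
        k ≤⟨ deg ⟩
        count X L + count Y L
          ≤⟨ +-mono-≤ (count-⊆ uniqueL (λ h e → inX h e , e)) (count-⊆ uniqueL (λ h e → inY h e , e)) ⟩
        count X ((x ∷ as) ++ (y ∷ bs)) + count Y ((x ∷ as) ++ (y ∷ bs))
          ≡⟨ cong₂ _+_ (count-++ X (x ∷ as) (y ∷ bs)) (count-++ Y (x ∷ as) (y ∷ bs)) ⟩
        count X (x ∷ as) + count X (y ∷ bs) + (count Y (x ∷ as) + count Y (y ∷ bs))
          ≡⟨ regroup (count X (x ∷ as)) _ _ _ ⟩
        (count X (x ∷ as) + count Y (x ∷ as)) + (count Y (y ∷ bs) + count X (y ∷ bs))
          ≡⟨ cong₂ (λ m n → (m + count Y (x ∷ as)) + (n + count X (y ∷ bs))) (dropHead X X⊆ as) (dropHead Y Y⊆ bs) ⟩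
        (count X as + count Y (x ∷ as)) + (count Y bs + count X (y ∷ bs))
          ≤⟨ +-mono-≤
               (count-crossing X Y x as (λ ps u v qs eq e e′ → no-crossing p ps u v qs eq (Y⊆ u e) (X⊆ v e′))
                 (λ ps u eq e → no-far-end p ps u eq (Y⊆ u e)))
               (count-crossing Y X y bs (λ ps u v qs eq e e′ → no-crossing (swapPair p) ps u v qs eq (X⊆ u e) (Y⊆ v e′))
                 (λ ps u eq e → no-far-end (swapPair p) ps u eq (X⊆ u e))) ⟩
        length as + length bs ∎
      trimˡ : ∀ as′ a → as ≡ as′ ∷ʳ a → X a ≡ false → Y a ≡ false → ⊥
      trimˡ as′ a refl ex ey = endpoint-degrees fuel X Y X⊆ Y⊆ p′
        (≤-trans (≤-reflexive (sym len)) enough) (keep ex inX) (keep ey inY) deg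
        where
        len : length (as′ ∷ʳ a) + length bs ≡ suc (length as′ + length bs)
        len = cong (_+ length bs) (trans (length-++ as′) (+-comm _ 1))
        perm : (x ∷ as′ ∷ʳ a) ++ (y ∷ bs) ↭ a ∷ ((x ∷ as′) ++ (y ∷ bs))
        perm = ↭-trans (↭-reflexive (++-assoc (x ∷ as′) (a ∷ []) (y ∷ bs))) (shift a (x ∷ as′) (y ∷ bs))
        keep : ∀ {Z : V → Bool} → Z a ≡ false → (∀ {v} → v ∈ L → Z v ≡ true → v ∈ (x ∷ as′ ∷ʳ a) ++ (y ∷ bs)) →
          ∀ {v} → v ∈ L → Z v ≡ true → v ∈ (x ∷ as′) ++ (y ∷ bs)
        keep ez inZ v∈L e with ∈-resp-↭ perm (inZ v∈L e)
        ... | here refl = contradiction (trans (sym ez) e) λ ()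
        ... | there h = h
        p′ : Pair x as′ y bs
        p′ = record
          { chainˡ = chain-++⁻ˡ (x ∷ as′) (chainˡ p) ; chainʳ = chainʳ p
          ; inside = AllPairs.tail (proj₁ (inside-↭ perm (inside p))) , λ h → proj₂ (inside-↭ perm (inside p)) (there h)
          ; long = s≤s (begin
              k                                     ≤⟨ excess ⟩
              length (as′ ∷ʳ a) + length bs         ≡⟨ len ⟩
              suc (length as′ + length bs)          ≡⟨ +-suc (length as′) (length bs) ⟨
              length as′ + length (y ∷ bs)          ≡⟨ length-++ as′ ⟨
              length (as′ ++ y ∷ bs)                ∎) }
      trimʳ : ∀ bs′ b → bs ≡ bs′ ∷ʳ b → X b ≡ false → Y b ≡ false → ⊥
      trimʳ bs′ b refl ex ey = endpoint-degrees fuel X Y X⊆ Y⊆ p′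
        (≤-trans (≤-reflexive (sym len)) enough) (keep ex inX) (keep ey inY) deg
        where
        len : length as + length (bs′ ∷ʳ b) ≡ suc (length as + length bs′)
        len = trans (cong (length as +_) (trans (length-++ bs′) (+-comm _ 1))) (+-suc _ _)
        perm : (x ∷ as) ++ (y ∷ bs′ ∷ʳ b) ↭ b ∷ ((x ∷ as) ++ (y ∷ bs′))
        perm = ↭-trans (↭-reflexive (sym (++-assoc (x ∷ as) (y ∷ bs′) (b ∷ [])))) (↭-++-comm ((x ∷ as) ++ (y ∷ bs′)) (b ∷ []))
        keep : ∀ {Z : V → Bool} → Z b ≡ false → (∀ {v} → v ∈ L → Z v ≡ true → v ∈ (x ∷ as) ++ (y ∷ bs′ ∷ʳ b)) →
          ∀ {v} → v ∈ L → Z v ≡ true → v ∈ (x ∷ as) ++ (y ∷ bs′)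
        keep ez inZ v∈L e with ∈-resp-↭ perm (inZ v∈L e)
        ... | here refl = contradiction (trans (sym ez) e) λ ()
        ... | there h = h
        p′ : Pair x as y bs′
        p′ = record
          { chainˡ = chainˡ p ; chainʳ = chain-++⁻ˡ (y ∷ bs′) (chainʳ p)
          ; inside = AllPairs.tail (proj₁ (inside-↭ perm (inside p))) , λ h → proj₂ (inside-↭ perm (inside p)) (there h)
          ; long = s≤s (begin
              k                                     ≤⟨ excess ⟩
              length as + length (bs′ ∷ʳ b)         ≡⟨ len ⟩
              suc (length as + length bs′)          ≡⟨ +-suc (length as) (length bs′) ⟨
              length as + length (y ∷ bs′)          ≡⟨ length-++ as ⟨
              length (as ++ y ∷ bs′)                ∎) }
      trim : InitLast as → InitLast bs → ⊥
      -- If one path is a single vertex, the excess puts more than k vertices on the other.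
      trim [] _ = <⇒≱ (pair-length p) excess
      trim _ [] = <⇒≱ (pair-length (swapPair p)) (≤-trans excess (≤-reflexive (+-identityʳ _)))
      trim (as′ ∷ʳ′ a) (bs′ ∷ʳ′ b) with Y a in ya | X b in xb | X a in xa | Y b in yb
      ... | true | _ | _ | _ = no-far-end p (x ∷ as′) a refl (Y⊆ a ya)
      ... | false | true | _ | _ = no-far-end (swapPair p) (y ∷ bs′) b refl (X⊆ b xb)
      ... | false | false | false | _ = trimˡ as′ a refl xa ya
      ... | false | false | true | false = trimʳ bs′ b refl xb yb
      ... | false | false | true | true = no-two-cycles p (x ∷ as′) a refl (X⊆ a xa) (y ∷ bs′) b refl (Y⊆ b yb)

    extend : ∀ {x as y bs} → Pair x as y bs → ∀ {v} → v ∈ L → v ∉ (x ∷ as) ++ (y ∷ bs) → adj x v ≡ true → Pair v (x ∷ as) y bs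
    extend p {v} v∈L v∉ e = record
      { chainˡ = flip e ∷ chainˡ p ; chainʳ = chainʳ p
      ; inside = All.tabulate (λ h eq → v∉ (subst (_∈ _) (sym eq) h)) ∷ proj₁ (inside p) ,
                 (λ { (here refl) → v∈L ; (there h) → proj₂ (inside p) h })
      ; long = m≤n⇒m≤1+n (long p) }

    -- A longest pair of disjoint paths whose initial vertices are nonadjacent vertices of P and Q
    -- absorbs all relevant neighbours of these two vertices.
    join-complete : (P Q : V → Bool) →
      (∀ {x x′} → x ∈ L → x′ ∈ L → P x ≡ true → P x′ ≡ true → Q x′ ≡ false → x ≢ x′ → adj x x′ ≡ true) →
      (∀ {x y} → x ∈ L → y ∈ L → P x ≡ true → Q y ≡ true → adj x y ≡ false →
         k ≤ count (λ v → adj x v ∧ P v) L + count (λ v → adj y v ∧ (P v ∨ Q v)) L) →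
      ∀ fuel {x as y bs} → Pair x as y bs → P x ≡ true → Q y ≡ true → adj x y ≡ false →
      length L < fuel + (length as + length bs) → ⊥
    join-complete P Q clique deg zero {x} {as} {y} {bs} p Px Qy exy enough = <⇒≱ enough (begin
      length as + length bs                  ≤⟨ +-mono-≤ (n≤1+n _) (n≤1+n _) ⟩
      length (x ∷ as) + length (y ∷ bs)      ≡⟨ length-++ (x ∷ as) ⟨
      length ((x ∷ as) ++ (y ∷ bs))          ≤⟨ unique-⊆-length (proj₁ (inside p)) (proj₂ (inside p)) ⟩
      length L                               ∎)
      where open ≤-Reasoning
    join-complete P Q clique deg (suc fuel) {x} {as} {y} {bs} p Px Qy exy enough
      with any? (λ v → ((adj x v ∧ P v) Bool.≟ true) ×-dec ¬? (v ∈? ((x ∷ as) ++ (y ∷ bs)))) L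
    ... | yes found with v , v∈L , e , v∉ ← find found = go (adj v y) refl
      where
      p′ : Pair v (x ∷ as) y bs
      p′ = extend p v∈L v∉ (proj₁ (∧-true e))
      go : ∀ b → adj v y ≡ b → ⊥
      go true evy = no-join (chainˡ p′) (chainʳ p′) (inside p′) (long p′) evy
      go false evy = join-complete P Q clique deg fuel p′ (proj₂ (∧-true {adj x v} e)) Qy evy
        (subst (length L <_) (sym (+-suc fuel _)) enough)
    ... | no ¬found with any? (λ v → ((adj y v ∧ (P v ∨ Q v)) Bool.≟ true) ×-dec ¬? (v ∈? ((x ∷ as) ++ (y ∷ bs)))) L
    ...   | yes found with v , v∈L , e , v∉ ← find found = go (adj v x) refl (Q v) refl
      where
      P∨Q : P v ∨ Q v ≡ true
      P∨Q = proj₂ (∧-true {adj y v} e)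
      p′ : Pair v (y ∷ bs) x as
      p′ = extend (swapPair p) v∈L (λ h → v∉ (∈-resp-↭ (↭-++-comm (y ∷ bs) (x ∷ as)) h)) (proj₁ (∧-true e))
      x∈L : x ∈ L
      x∈L = proj₂ (inside p) (here refl)
      go : ∀ b → adj v x ≡ b → ∀ q → Q v ≡ q → ⊥
      go true evx _ _ = no-join (chainˡ p′) (chainʳ p′) (inside p′) (long p′) evx
      go false evx true Qv = join-complete P Q clique deg fuel (swapPair p′) Px Qv (trans (adj-sym x v) evx)
        (subst (length L <_) (trans (sym (+-suc fuel _)) (cong (fuel +_) (sym (+-suc (length as) (length bs))))) enough)
      -- Here v lies in P but not in Q, so it may not become the new initial vertex in place of y;
      -- but then the clique condition makes it adjacent to x.
      go false evx false Qv = contradiction (trans (sym evx) (flip (clique x∈L v∈L Px Pv Qv (λ { refl → v∉ (here refl) })))) λ ()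
        where
        Pv : P v ≡ true
        Pv with P v | P∨Q
        ... | true | _ = refl
        ... | false | h = contradiction (trans (sym Qv) h) λ ()
    ...   | no ¬found′ = endpoint-degrees (suc (length as + length bs)) (λ v → adj x v ∧ P v) (λ v → adj y v ∧ (P v ∨ Q v))
        (λ v e → proj₁ (∧-true e)) (λ v e → proj₁ (∧-true e)) p ≤-refl (absorbed ¬found) (absorbed ¬found′)
        (deg (proj₂ (inside p) (here refl)) (proj₂ (inside p) (∈-++⁺ʳ (x ∷ as) (here refl))) Px Qy exy)
      where
      absorbed : ∀ {Z : V → Bool} → ¬ Any (λ v → Z v ≡ true × v ∉ (x ∷ as) ++ (y ∷ bs)) L →
        ∀ {v} → v ∈ L → Z v ≡ true → v ∈ (x ∷ as) ++ (y ∷ bs)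
      absorbed ¬any {v} v∈L e with v ∈? ((x ∷ as) ++ (y ∷ bs))
      ... | yes h = h
      ... | no h = contradiction (lose v∈L (e , h)) ¬any

filterᵇ-partition : ∀ (p : A → Bool) L → L ↭ filterᵇ p L ++ filterᵇ (not ∘ p) L
filterᵇ-partition p [] = ↭refl
filterᵇ-partition p (x ∷ L) with p x
... | true = ↭prep x (filterᵇ-partition p L)
... | false = ↭-trans (↭prep x (filterᵇ-partition p L)) (↭-sym (shift x (filterᵇ p L) _))

half : ∀ n → ∃ λ t → t + t ≤ n × n ≤ suc (t + t)
half zero = 0 , z≤n , z≤n
half (suc zero) = 0 , z≤n , ≤-refl
half (suc (suc n)) with t , lo , hi ← half n =
  suc t , s≤s (≤-trans (≤-reflexive (+-suc t t)) (s≤s lo)) , s≤s (s≤s (≤-trans hi (≤-reflexive (sym (+-suc t t)))))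

isEdge-none : ∀ {c} → isEdge c ≡ false → c ≡ none
isEdge-none {none} _ = refl

-- Saturation by red edges

module _ {N : ℕ} where

  adjacent : RBGraph N → Fin N → Fin N → Bool
  adjacent G = Coloured.adj (col G)

  adjacent-sym : ∀ G x y → adjacent G x y ≡ adjacent G y x
  adjacent-sym G x y = cong isEdge (symm G x y)

  adjacent-irrefl : ∀ G x → adjacent G x x ≡ false
  adjacent-irrefl G x = cong isEdge (irr G x)

  PathFreeOn : RBGraph N → ℕ → List (Fin N) → Set
  PathFreeOn G = Paths.LongPathFree _≟ᶠ_ (adjacent G) (adjacent-sym G) (adjacent-irrefl G)

  addRed : RBGraph N → ∀ {x y} → x ≢ y → RBGraph N
  addRed G {x} {y} x≢y = record { col = col′ ; symm = symm′ ; irr = irr′ }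
    where
    new : Fin N → Fin N → Bool
    new i j = (⌊ i ≟ᶠ x ⌋ ∧ ⌊ j ≟ᶠ y ⌋) ∨ (⌊ i ≟ᶠ y ⌋ ∧ ⌊ j ≟ᶠ x ⌋)
    col′ : Fin N → Fin N → Col
    col′ i j = if new i j then red else col G i j
    symm′ : ∀ i j → col′ i j ≡ col′ j i
    symm′ i j = cong₂ (λ b c → if b then red else c) new-sym (symm G i j)
      where
      new-sym : new i j ≡ new j i
      new-sym = trans (∨-comm (⌊ i ≟ᶠ x ⌋ ∧ ⌊ j ≟ᶠ y ⌋) _) (cong₂ _∨_ (∧-comm ⌊ i ≟ᶠ y ⌋ _) (∧-comm ⌊ i ≟ᶠ x ⌋ _))
    irr′ : ∀ i → col′ i i ≡ none
    irr′ i with i ≟ᶠ x | i ≟ᶠ y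
    ... | yes refl | yes refl = contradiction refl x≢y
    ... | yes _ | no _ = irr G i
    ... | no _ | yes _ = irr G i
    ... | no _ | no _ = irr G i

  module AddRed (G : RBGraph N) {x y : Fin N} (x≢y : x ≢ y) (nonadj : adjacent G x y ≡ false) where
    private
      G′ = addRed G x≢y
      module C = Coloured (col G)
      module C′ = Coloured (col G′)

    new-edge : col G′ x y ≡ red
    new-edge with x ≟ᶠ x | y ≟ᶠ y
    ... | yes _ | yes _ = refl
    ... | no x≢x | _ = contradiction refl x≢x
    ... | _ | no y≢y = contradiction refl y≢y

    edge-cases : ∀ i j → col G′ i j ≡ col G i j ⊎ (col G′ i j ≡ red × col G i j ≡ none × (i ≡ x × j ≡ y ⊎ i ≡ y × j ≡ x))
    edge-cases i j with i ≟ᶠ x | j ≟ᶠ y | i ≟ᶠ y | j ≟ᶠ x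
    ... | yes refl | yes refl | _ | _ = inj₂ (refl , isEdge-none nonadj , inj₁ (refl , refl))
    ... | yes refl | no _ | yes refl | _ = contradiction refl x≢y
    ... | no _ | _ | yes refl | yes refl = inj₂ (refl , isEdge-none (trans (adjacent-sym G y x) nonadj) , inj₂ (refl , refl))
    ... | yes refl | no _ | no _ | _ = inj₁ refl
    ... | no _ | _ | no _ | _ = inj₁ refl
    ... | no _ | _ | yes _ | no _ = inj₁ refl

    same-blue : ∀ i j → C.blueE i j ≡ C′.blueE i j
    same-blue i j with edge-cases i j
    ... | inj₁ e = cong isBlue (sym e)
    ... | inj₂ (e , e′ , _) = trans (cong isBlue e′) (cong isBlue (sym e))

    more-red : ∀ i j → C.redE i j ≡ true → C′.redE i j ≡ true
    more-red i j h with edge-cases i j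
    ... | inj₁ e = trans (cong isRed e) h
    ... | inj₂ (e , _) = cong isRed e

    -- A new blue edge need not create a blue K_r, whereas a new red edge always raises the weight;
    -- this strictness limits how often `saturation` can add one.
    total-increases : ∀ r {L} → x ∈ L → y ∈ L → C.total r L < C′.total r L
    total-increases r {L} x∈L y∈L with M , p ← ∈⇒↭ x∈L with ∈-resp-↭ p y∈L
    ... | here y≡x = contradiction (sym y≡x) x≢y
    ... | there y∈M with N′ , q ← ∈⇒↭ y∈M =
      subst₂ _<_ (sym (C.Symmetric.total-↭ (symm G) r perm)) (sym (C′.Symmetric.total-↭ (symm G′) r perm))
        (≤-trans (≤-reflexive (sym (+-suc (cliques C.blueE r K) _))) (+-mono-≤ (≤-reflexive (cliques-cong same-blue r K)) reds))
      where
      K = x ∷ y ∷ N′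
      perm : L ↭ K
      perm = ↭-trans p (↭prep x q)
      reds : cliques C.redE 2 K < cliques C′.redE 2 K
      reds rewrite cliques-one C.redE (filterᵇ (C.redE x) (y ∷ N′)) | cliques-one C′.redE (filterᵇ (C′.redE x) (y ∷ N′))
        | new-edge | isEdge-none nonadj =
        ≤-trans (≤-reflexive (sym (+-suc (cliques C.redE 2 (y ∷ N′)) _)))
          (+-mono-≤ (edges-mono more-red (y ∷ N′)) (s≤s (length-filterᵇ-mono (more-red x) N′)))

    module _ {L : List (Fin N)} {k : ℕ} (uniqueL : Unique L) (pathFree : PathFreeOn G k L)
      (connected : Paths.Connected _≟ᶠ_ (adjacent G) (adjacent-sym G) (adjacent-irrefl G) L) where
      private
        module P = Paths _≟ᶠ_ (adjacent G) (adjacent-sym G) (adjacent-irrefl G)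
        module P′ = Paths _≟ᶠ_ (adjacent G′) (adjacent-sym G′) (adjacent-irrefl G′)
        module H = P.Host L k uniqueL pathFree connected

      old-or-new : ∀ {i j} → adjacent G′ i j ≡ true → adjacent G i j ≡ true ⊎ (i ≡ x × j ≡ y ⊎ i ≡ y × j ≡ x)
      old-or-new {i} {j} h with edge-cases i j
      ... | inj₁ e = inj₁ (trans (cong isEdge (sym e)) h)
      ... | inj₂ (_ , _ , c) = inj₂ c

      avoiding : ∀ {z P} → z ≡ x ⊎ z ≡ y → z ∉ P → P′.Chain P → P.Chain P
      avoiding h z∉ [] = []
      avoiding h z∉ [-] = [-]
      avoiding h z∉ (e ∷ c) with old-or-new e | h
      ... | inj₁ e′ | _ = e′ ∷ avoiding h (z∉ ∘ there) c
      ... | inj₂ (inj₁ (refl , refl)) | inj₁ refl = contradiction (here refl) z∉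
      ... | inj₂ (inj₁ (refl , refl)) | inj₂ refl = contradiction (there (here refl)) z∉
      ... | inj₂ (inj₂ (refl , refl)) | inj₁ refl = contradiction (there (here refl)) z∉
      ... | inj₂ (inj₂ (refl , refl)) | inj₂ refl = contradiction (here refl) z∉

      -- A long path of the new graph must use the new edge, and only once because its vertices are
      -- distinct. Cut there, it falls into two disjoint old paths starting at x and y. The part
      -- already scanned is kept reversed, so that it starts at the current vertex.
      still-pathFree : (∀ as bs → ¬ H.Pair x as y bs) → PathFreeOn G′ k L
      still-pathFree noPair [] c ins ()
      still-pathFree noPair (u ∷ P) c ins long = scan [] u P [-] c ins long
        where
        scan : ∀ done u rest → P.Chain (u ∷ done) → P′.Chain (u ∷ rest) → P.Inside L ((u ∷ done) ++ rest) →
          k < length ((u ∷ done) ++ rest) → ⊥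
        scan done u [] cd _ ins long = pathFree (u ∷ done) cd
          (P.inside-↭ (↭-reflexive (++-identityʳ (u ∷ done))) ins) (subst (k <_) (cong length (++-identityʳ (u ∷ done))) long)
        scan done u (w ∷ rest) cd (e ∷ cr) ins long = continue (old-or-new e)
          where
          u∉ : u ∉ w ∷ rest
          u∉ = proj₂ (proj₂ (P.unique-++⁻ (u ∷ done) (proj₁ ins))) (here refl)
          perm : (u ∷ done) ++ w ∷ rest ↭ (w ∷ u ∷ done) ++ rest
          perm = shift w (u ∷ done) rest
          continue : adjacent G u w ≡ true ⊎ (u ≡ x × w ≡ y ⊎ u ≡ y × w ≡ x) → ⊥
          continue (inj₁ e′) = scan (u ∷ done) w rest (trans (adjacent-sym G w u) e′ ∷ cd) cr
            (P.inside-↭ perm ins) (subst (k <_) (↭-length perm) long)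
          continue (inj₂ (inj₁ (refl , refl))) = noPair done rest
            (record { chainˡ = cd ; chainʳ = avoiding (inj₁ refl) u∉ cr ; inside = ins ; long = long })
          continue (inj₂ (inj₂ (refl , refl))) = noPair rest done (H.swapPair
            (record { chainˡ = cd ; chainʳ = avoiding (inj₂ refl) u∉ cr ; inside = ins ; long = long }))

∈-nonempty : ∀ {x : A} {L} → x ∈ L → 1 ≤ length L
∈-nonempty (here _) = s≤s z≤n
∈-nonempty (there _) = s≤s z≤n

-- Successive deletion of vertices of low degree

module Graph {N : ℕ} (G : RBGraph N) (ρ : ℕ) where
  open Weights ρ
  open Coloured (col G) using (adj; degree; total; total-++; total-cost)
  open Coloured.Symmetric (col G) (symm G) using (total-↭; total≤weight)
  open Paths _≟ᶠ_ adj (adjacent-sym G) (adjacent-irrefl G)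
  open DecMembership (_≟ᶠ_ {N}) using (_∈?_)

  private
    V : Set
    V = Fin N

  mem : List V → V → Bool
  mem M v = ⌊ v ∈? M ⌋

  mem⁺ : ∀ {M v} → v ∈ M → mem M v ≡ true
  mem⁺ {M} {v} h with v ∈? M
  ... | yes _ = refl
  ... | no ¬h = contradiction h ¬h

  mem⁻ : ∀ {M v} → mem M v ≡ true → v ∈ M
  mem⁻ {M} {v} h with v ∈? M
  ... | yes q = q

  ∉⇒mem : ∀ {M v} → v ∉ M → mem M v ≡ false
  ∉⇒mem {M} {v} h with v ∈? M
  ... | yes q = contradiction q h
  ... | no _ = refl

  mem⇒∉ : ∀ {M v} → mem M v ≡ false → v ∉ M
  mem⇒∉ {M} {v} h with v ∈? M
  ... | no q = q

  degree-↭ : ∀ x {L M} → L ↭ M → degree x L ≡ degree x M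
  degree-↭ x p = ↭-length (filter-↭ (T? ∘ adj x) p)

  degree-++ʳ : ∀ x L {M} → degree x M ≤ degree x (L ++ M)
  degree-++ʳ x L {M} = ≤-trans (m≤n+m _ _) (≤-reflexive (sym
    (trans (cong length (filterᵇ-++ (adj x) L M)) (length-++ (filterᵇ (adj x) L)))))

  degree-self : ∀ {x L M} → L ↭ x ∷ M → degree x L ≡ degree x M
  degree-self {x} {L} {M} p = trans (degree-↭ x p) drop
    where
    drop : degree x (x ∷ M) ≡ degree x M
    drop rewrite adjacent-irrefl G x = refl

  -- Greedy deletion with a budget of m vertices that spares the protected set K; `stuck` tells why
  -- it ended. The field `low` measures degrees into the final core, not at the time of deletion:
  -- this is what `X⊆H` needs about the vertices outside H.
  record Peeled (K : V → Bool) (d m : ℕ) (L : List V) : Set where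
    field
      {peel core} : List V
      split     : L ↭ peel ++ core
      peel≤m    : length peel ≤ m
      loss      : total r L ≤ length peel * cost d + total r core
      stuck     : length peel ≡ m ⊎ (∀ {y} → y ∈ core → K y ≡ false → d < degree y core)
      low       : ∀ {y} → y ∈ peel → degree y core ≤ d × K y ≡ false

  peeling : ∀ K d m L → Peeled K d m L
  peeling K d zero L = record
    { peel = [] ; split = ↭refl ; peel≤m = z≤n ; loss = ≤-refl ; stuck = inj₁ refl ; low = λ () }
  peeling K d (suc m) L with any? (λ v → (K v Bool.≟ false) ×-dec (degree v L ≤? d)) L
  ... | no ¬found = record
    { peel = [] ; split = ↭refl ; peel≤m = z≤n ; loss = ≤-refl
    ; stuck = inj₂ (λ y∈L Cy → ≰⇒> λ h → ¬found (lose y∈L (Cy , h))) ; low = λ () }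
  ... | yes found with v , v∈L , Cv , deg≤d ← find found with M , p ← ∈⇒↭ v∈L = record
    { peel = v ∷ peel ; core = core
    ; split = ↭-trans p (↭prep v split) ; peel≤m = s≤s peel≤m
    ; loss = begin
        total r L                                             ≡⟨ total-↭ r p ⟩
        total r (v ∷ M)                                       ≤⟨ total-cost ρ M degM ⟩
        total r M + cost d                                    ≤⟨ +-monoˡ-≤ (cost d) loss ⟩
        length peel * cost d + total r core + cost d          ≡⟨ lemma (length peel * cost d) (total r core) (cost d) ⟩
        cost d + length peel * cost d + total r core          ∎
    ; stuck = map₁ (cong suc) stuck
    ; low = λ { (here refl) → ≤-trans (degree-++ʳ v peel) (≤-trans (≤-reflexive (sym (degree-↭ v split))) degM) , Cv
              ; (there h) → low h } }
    where
    open ≤-Reasoning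
    open Peeled (peeling K d m M)
    degM : degree v M ≤ d
    degM = ≤-trans (≤-reflexive (sym (degree-self p))) deg≤d
    lemma : ∀ a b c → a + b + c ≡ c + a + b
    lemma = solve-∀

  -- Refuting a counterexample on more than k vertices

  module Step (k′ : ℕ) (L : List V) (uniqueL : Unique L)
    (pathFree : LongPathFree (suc k′) L) (k<n : suc k′ < length L)
    (shorter : ∀ {M} → Unique M → (∀ {v} → v ∈ M → v ∈ L) → length M < length L →
       total r M ≤ Extremal.extremal (suc k′) (length M))
    (saturate : ∀ {x y} → x ∈ L → y ∈ L → (x≢y : x ≢ y) → adj x y ≡ false → PathFreeOn (addRed G x≢y) (suc k′) L →
       total r L ≤ Extremal.extremal (suc k′) (length L))
    (failure : ¬ (total r L ≤ Extremal.extremal (suc k′) (length L))) where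

    open Extremal (suc k′)

    k : ℕ
    k = suc k′

    -- If no edge leaves R, the weight is the sum over the parts inside and outside R. Both are
    -- smaller, so the induction and superadditivity prove the bound.
    connected : Connected L
    connected R {a} {b} a∈R R⊆L b∈L b∉R
      with any? (λ u → any? (λ w → (adj u w Bool.≟ true) ×-dec ¬? (w ∈? R)) L) R
    ... | yes found with u , u∈R , found′ ← find found with w , w∈L , e , w∉R ← find found′ = u , w , u∈R , w∈L , w∉R , e
    ... | no ¬found = contradiction (begin
      total r L                                     ≡⟨ total-↭ r p ⟩
      total r (L₁ ++ L₂)                            ≡⟨ total-++ (suc ρ) L₁ (All.tabulate λ h₁ → All.tabulate λ h₂ → apart h₁ h₂) ⟩
      total r L₁ + total r L₂
        ≤⟨ +-mono-≤
             (shorter (Unique-filter⁺ _ uniqueL) (proj₁ ∘ ∈-filterᵇ⁻ L)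
               (≤-trans (m<m+n _ (∈-nonempty b∈L₂)) (≤-reflexive (sym len))))
             (shorter (Unique-filter⁺ _ uniqueL) (proj₁ ∘ ∈-filterᵇ⁻ L)
               (≤-trans (m<n+m _ (∈-nonempty a∈L₁)) (≤-reflexive (sym len)))) ⟩
      extremal (length L₁) + extremal (length L₂)   ≤⟨ extremal-superadditive (length L₁) (length L₂) ⟩
      extremal (length L₁ + length L₂)              ≡⟨ cong extremal len ⟨
      extremal (length L)                           ∎) failure
      where
      open ≤-Reasoning
      L₁ L₂ : List V
      L₁ = filterᵇ (mem R) L
      L₂ = filterᵇ (not ∘ mem R) L
      p : L ↭ L₁ ++ L₂
      p = filterᵇ-partition (mem R) L
      len : length L ≡ length L₁ + length L₂
      len = trans (↭-length p) (length-++ L₁)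
      a∈L₁ : a ∈ L₁
      a∈L₁ = ∈-filterᵇ⁺ (R⊆L a∈R) (mem⁺ a∈R)
      b∈L₂ : b ∈ L₂
      b∈L₂ = ∈-filterᵇ⁺ b∈L (cong not (∉⇒mem b∉R))
      apart : ∀ {u w} → u ∈ L₁ → w ∈ L₂ → adj u w ≡ false
      apart {u} {w} h₁ h₂ with adj u w in e
      ... | false = refl
      ... | true = contradiction (lose (mem⁻ (proj₂ (∈-filterᵇ⁻ L h₁)))
        (lose (proj₁ (∈-filterᵇ⁻ L h₂)) (e , mem⇒∉ (not-true (proj₂ (∈-filterᵇ⁻ L h₂)))))) ¬found
        where
        not-true : ∀ {b} → not b ≡ true → b ≡ false
        not-true {false} _ = refl

    open Host L k uniqueL pathFree connected using (Pair; count; join-complete)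

    -- Saturation in contrapositive form: without a pair of paths the edge could be added, and the
    -- bound for the enlarged graph implies the one that fails. No saturated graph has to be chosen.
    no-pair⇒⊥ : ∀ {x y} → x ∈ L → y ∈ L → x ≢ y → adj x y ≡ false → (∀ as bs → ¬ Pair x as y bs) → ⊥
    no-pair⇒⊥ x∈L y∈L x≢y e noPair =
      failure (saturate x∈L y∈L x≢y e (AddRed.still-pathFree G x≢y e uniqueL pathFree connected noPair))

    complete-between : (P Q : V → Bool) →
      (∀ {x x′} → x ∈ L → x′ ∈ L → P x ≡ true → P x′ ≡ true → Q x′ ≡ false → x ≢ x′ → adj x x′ ≡ true) →
      (∀ {x y} → x ∈ L → y ∈ L → P x ≡ true → Q y ≡ true → adj x y ≡ false →
         k ≤ count (λ v → adj x v ∧ P v) L + count (λ v → adj y v ∧ (P v ∨ Q v)) L) →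
      ∀ {x y} → x ∈ L → y ∈ L → P x ≡ true → Q y ≡ true → x ≢ y → adj x y ≡ true
    complete-between P Q clique deg {x} {y} x∈L y∈L Px Qy x≢y with adj x y in e
    ... | true = refl
    ... | false = ⊥-elim (no-pair⇒⊥ x∈L y∈L x≢y e λ as bs pair →
      join-complete P Q clique deg (suc (length L)) pair Px Qy e (s≤s (m≤m+n _ _)))

    ∈-core : ∀ {K d m} (peeled : Peeled K d m L) {v} → v ∈ Peeled.core peeled → v ∈ L
    ∈-core peeled h = ∈-resp-↭ (↭-sym (Peeled.split peeled)) (∈-++⁺ʳ (Peeled.peel peeled) h)

    unique-core : ∀ {K d m} (peeled : Peeled K d m L) → Unique (Peeled.core peeled)
    unique-core peeled = proj₁ (proj₂ (unique-++⁻ (Peeled.peel peeled) (Unique-resp-↭ (Peeled.split peeled) uniqueL)))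

    length-split : ∀ {K d m} (peeled : Peeled K d m L) → length L ≡ length (Peeled.peel peeled) + length (Peeled.core peeled)
    length-split peeled = trans (↭-length (Peeled.split peeled)) (length-++ (Peeled.peel peeled))

    t : ℕ
    t = proj₁ (half k′)

    2t<k : t + t < k
    2t<k = s≤s (proj₁ (proj₂ (half k′)))

    k≤2t+2 : k ≤ suc t + suc t
    k≤2t+2 = s≤s (≤-trans (proj₂ (proj₂ (half k′))) (≤-reflexive (sym (+-suc t t))))

    first : Peeled (λ _ → false) t k L
    first = peeling (λ _ → false) t k L

    open Peeled first renaming (peel to J; core to H; split to splitH; loss to lossH; stuck to stuckH; low to lowH; peel≤m to J≤k)

    J<k : length J < k
    J<k = ≤∧≢⇒< J≤k λ J≡k → failure (begin
      total r L                                 ≤⟨ lossH ⟩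
      length J * cost t + total r H             ≡⟨ cong (λ j → j * cost t + total r H) J≡k ⟩
      k * cost t + total r H                    ≤⟨ +-mono-≤ (cost-total {t} 2t<k) (shorter (unique-core first) (∈-core first) (H<L J≡k)) ⟩
      weight k + extremal (length H)            ≡⟨ extremal-+k (length H) ⟨
      extremal (k + length H)                   ≡⟨ cong (λ j → extremal (j + length H)) J≡k ⟨
      extremal (length J + length H)            ≡⟨ cong extremal (length-split first) ⟨
      extremal (length L)                       ∎)
      where
      open ≤-Reasoning
      H<L : length J ≡ k → length H < length L
      H<L J≡k = ≤-trans (m<n+m (length H) {length J} (≤-trans (s≤s z≤n) (≤-reflexive (sym J≡k)))) (≤-reflexive (sym (length-split first)))

    degreeH : ∀ {y} → y ∈ H → t < degree y H
    degreeH y∈H with stuckH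
    ... | inj₁ J≡k = contradiction J≡k (<⇒≢ J<k)
    ... | inj₂ h = h y∈H refl

    degree≤count : ∀ {M y} {Z : V → Bool} → Unique M → (∀ {v} → v ∈ M → v ∈ L) → (∀ {v} → v ∈ M → Z v ≡ true) →
      degree y M ≤ count (λ v → adj y v ∧ Z v) L
    degree≤count uM M⊆L M⊆Z = count-⊆ uM λ h e → M⊆L h , cong₂ _∧_ e (M⊆Z h)

    -- With P = Q the clique condition is vacuous, and two degrees inside H add up to at least
    -- 2(t+1) ≥ k.
    H-complete : ∀ {x y} → x ∈ H → y ∈ H → x ≢ y → adj x y ≡ true
    H-complete x∈H y∈H = complete-between (mem H) (mem H)
      (λ _ _ _ e e′ _ → contradiction (trans (sym e) e′) λ ())
      (λ _ _ Px Qy _ → ≤-trans k≤2t+2 (+-mono-≤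
        (≤-trans (degreeH (mem⁻ Px)) (degree≤count (unique-core first) (∈-core first) mem⁺))
        (≤-trans (degreeH (mem⁻ Qy)) (degree≤count (unique-core first) (∈-core first) (λ h → cong (λ b → b ∨ b) (mem⁺ h))))))
      (∈-core first x∈H) (∈-core first y∈H) (mem⁺ x∈H) (mem⁺ y∈H)

    s c : ℕ
    s = length H
    c = k ∸ s

    s≤k : s ≤ k
    s≤k = ≮⇒≥ (pathFree H (AllPairs⇒Linked (pairs (unique-core first) H-complete)) (unique-core first , ∈-core first))
      where
      pairs : ∀ {M} → Unique M → (∀ {x y} → x ∈ M → y ∈ M → x ≢ y → adj x y ≡ true) → AllPairs (λ x y → adj x y ≡ true) M
      pairs [] h = []
      pairs (x∉ ∷ u) h = All.tabulate (λ y∈ → h (here refl) (there y∈) (All.lookup x∉ y∈)) ∷ pairs u (λ a b → h (there a) (there b))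

    s+c≡k : s + c ≡ k
    s+c≡k = m+[n∸m]≡n s≤k

    memberH : ∃ λ x → x ∈ H
    memberH with H | length-split first
    ... | [] | len = contradiction (≤-trans k<n (≤-trans (≤-reflexive (trans len (+-identityʳ _))) J≤k)) (<-irrefl refl)
    ... | x ∷ _ | _ = x , here refl

    degreeH≡ : ∀ {x} → x ∈ H → suc (degree x H) ≡ s
    degreeH≡ {x} x∈H with M , p ← ∈⇒↭ x∈H = trans (cong suc (trans (degree-self p) (cong length (filterᵇ-all (All.tabulate λ y∈M →
      H-complete x∈H (∈-resp-↭ (↭-sym p) (there y∈M)) (All.lookup (AllPairs.head (Unique-resp-↭ p (unique-core first))) y∈M))))))
      (sym (↭-length p))

    t+1<s : suc t < s
    t+1<s = ≤-trans (s≤s (degreeH (proj₂ memberH))) (≤-reflexive (degreeH≡ (proj₂ memberH)))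

    -- Otherwise 2s ≤ s + c = k ≤ 2(t+1) < 2s.
    c<s : c < s
    c<s = ≰⇒> λ s≤c → <⇒≱ (+-mono-<-≤ t+1<s (<⇒≤ t+1<s)) (≤-trans (+-monoʳ-≤ s s≤c) (≤-trans (≤-reflexive s+c≡k) k≤2t+2))

    second : Peeled (mem H) c (length L) L
    -- The budget cannot be used up since H is protected and nonempty, so deletion ends only when
    -- every remaining vertex outside H has degree above c.
    second = peeling (mem H) c (length L) L

    open Peeled second renaming (peel to J₂; core to X; split to splitX; loss to lossX; stuck to stuckX; low to lowX)

    H⊆X : ∀ {v} → v ∈ H → v ∈ X
    H⊆X {v} v∈H with ∈-++⁻ J₂ (∈-resp-↭ splitX (∈-core first v∈H))
    ... | inj₁ v∈J = contradiction (trans (sym (mem⁺ v∈H)) (proj₂ (lowX v∈J))) λ ()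
    ... | inj₂ v∈X = v∈X

    degreeX : ∀ {y} → y ∈ X → y ∉ H → c < degree y X
    degreeX y∈X y∉H with stuckX
    ... | inj₂ h = h y∈X (∉⇒mem y∉H)
    ... | inj₁ J₂≡L = contradiction (≤-trans (m<m+n _ (∈-nonempty y∈X)) (≤-reflexive (sym (length-split second)))) (<-irrefl J₂≡L)

    -- A surviving vertex outside H has at least c + 1 neighbours in X, and a vertex of H has s - 1
    -- in H, together at least k. So every survivor outside H would be adjacent to all s > t
    -- vertices of H; but it was deleted in the first round and has at most t neighbours in H.
    X⊆H : ∀ {y} → y ∈ X → y ∈ H
    X⊆H {y} y∈X with y ∈? H
    ... | yes y∈H = y∈H
    ... | no y∉H with any? (λ x → adj y x Bool.≟ false) H
    ...   | no ¬found = contradiction (≤-trans (<⇒≤ t+1<s) (≤-trans (≤-reflexive (sym allH)) degree≤t)) (<-irrefl refl)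
      where
      degree≤t : degree y H ≤ t
      degree≤t with ∈-++⁻ J (∈-resp-↭ splitH (∈-core second y∈X))
      ... | inj₁ y∈J = proj₁ (lowH y∈J)
      ... | inj₂ y∈H = contradiction y∈H y∉H
      not-false : ∀ {b} → ¬ (b ≡ false) → b ≡ true
      not-false {true} _ = refl
      not-false {false} h = contradiction refl h
      allH : degree y H ≡ s
      allH = cong length (filterᵇ-all (All.tabulate λ h → not-false λ e → ¬found (lose h e)))
    ...   | yes found with x , x∈H , e ← find found =
      contradiction (trans (sym (trans (adjacent-sym G x y) e)) x~y) λ ()
      where
      Q : V → Bool
      Q v = mem X v ∧ not (mem H v)
      X⊆P∨Q : ∀ {v} → v ∈ X → mem H v ∨ Q v ≡ true
      X⊆P∨Q {v} h with mem H v
      ... | true = refl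
      ... | false rewrite mem⁺ h = refl
      Q⇒∉ : ∀ {v} → Q v ≡ true → v ∉ H
      Q⇒∉ {v} q v∈H with mem X v
      ... | true = contradiction (trans (sym q) (cong not (mem⁺ v∈H))) λ ()
      Q⇒∈ : ∀ {v} → Q v ≡ true → v ∈ X
      Q⇒∈ q = mem⁻ (proj₁ (∧-true q))
      x~y : adj x y ≡ true
      x~y = complete-between (mem H) Q
        (λ _ _ h h′ _ x≢ → H-complete (mem⁻ h) (mem⁻ h′) x≢)
        (λ {x} {y} _ _ Px Qy _ → ≤-pred (begin
          suc k                                         ≡⟨ cong suc s+c≡k ⟨
          suc (s + c)                                   ≡⟨ +-suc s c ⟨
          s + suc c                                     ≤⟨ +-mono-≤ (≤-reflexive (sym (degreeH≡ (mem⁻ Px)))) (degreeX (Q⇒∈ Qy) (Q⇒∉ Qy)) ⟩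
          suc (degree x H + degree y X)                 ≤⟨ s≤s (+-mono-≤ (degree≤count (unique-core first) (∈-core first) mem⁺)
                                                                         (degree≤count (unique-core second) (∈-core second) X⊆P∨Q)) ⟩
          suc (count (λ v → adj x v ∧ mem H v) L + count (λ v → adj y v ∧ (mem H v ∨ Q v)) L) ∎))
        (∈-core first x∈H) (∈-core second y∈X) (mem⁺ x∈H) (cong₂ _∧_ (mem⁺ y∈X) (cong not (∉⇒mem y∉H)))
        (λ { refl → y∉H x∈H })
        where open ≤-Reasoning

    X≡s : length X ≡ s
    X≡s = ≤-antisym (unique-⊆-length (unique-core second) X⊆H) (unique-⊆-length (unique-core first) H⊆X)

    q : ℕ
    q = length L ∸ k

    k+q≡n : k + q ≡ length L
    k+q≡n = m+[n∸m]≡n (<⇒≤ k<n)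

    J₂≡c+q : length J₂ ≡ c + q
    J₂≡c+q = +-cancelʳ-≡ s (length J₂) (c + q) (begin
      length J₂ + s           ≡⟨ cong (length J₂ +_) (sym X≡s) ⟩
      length J₂ + length X    ≡⟨ length-split second ⟨
      length L                ≡⟨ k+q≡n ⟨
      k + q                   ≡⟨ cong (_+ q) (sym s+c≡k) ⟩
      s + c + q               ≡⟨ lemma s c q ⟩
      c + q + s               ∎)
      where
      open ≡-Reasoning
      lemma : ∀ a b d → a + b + d ≡ b + d + a
      lemma = solve-∀

    -- The first round deleted fewer than k vertices and left at most k, so n < 2k and the rest
    -- beyond one block is a proper remainder.
    q<k : q < k
    q<k = +-cancelˡ-< k q k (≤-<-trans (≤-reflexive (trans k+q≡n (length-split first))) (+-mono-<-≤ J<k s≤k))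

    absurd : ⊥
    absurd = failure (begin
      total r L                               ≤⟨ lossX ⟩
      length J₂ * cost c + total r X          ≤⟨ +-mono-≤ (≤-reflexive (cong (_* cost c) J₂≡c+q)) (total≤weight ρ s X X≡s) ⟩
      (c + q) * cost c + weight s             ≡⟨ +-comm ((c + q) * cost c) (weight s) ⟩
      weight s + (c + q) * cost c             ≤⟨ core-plus-sparse c q c<s ⟩
      weight (s + c) + weight q               ≡⟨ cong₂ (λ a b → weight a + b) s+c≡k (sym (extremal-small q<k)) ⟩
      weight k + extremal q                   ≡⟨ extremal-+k q ⟨
      extremal (k + q)                        ≡⟨ cong extremal k+q≡n ⟩
      extremal (length L)                     ∎)
      where open ≤-Reasoning

-- The upper bound by induction on the number of vertices

module UpperBound (ρ k′ : ℕ) where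
  open Weights ρ
  open Extremal (suc k′)

  private
    g[_] : ∀ {N} → RBGraph N → List (Fin N) → ℕ
    g[ G ] = Coloured.total (col G) r

  -- Quantified over the graph as well as the list: saturation changes the colours, deletion only
  -- shortens L.
  Bounded : ℕ → Set
  Bounded b = ∀ {N} (G : RBGraph N) {L} → Unique L → PathFreeOn G (suc k′) L → length L < b → g[ G ] L ≤ extremal (length L)

  -- Induction on the room left for further red edges.
  saturation : ∀ {b} → Bounded b → ∀ m {N} (G : RBGraph N) {L} → Unique L → PathFreeOn G (suc k′) L → length L < suc b →
    weight (length L) < m + g[ G ] L → g[ G ] L ≤ extremal (length L)
  saturation ih zero G {L} uL free L≤b room =
    contradiction (Coloured.Symmetric.total≤weight (col G) (symm G) ρ (length L) L refl) (<⇒≱ room)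
  saturation ih (suc m) G {L} uL free L≤b room with length L ≤? suc k′
  ... | yes L≤k = ≤-trans (Coloured.Symmetric.total≤weight (col G) (symm G) ρ (length L) L refl) (weight≤extremal L≤k)
  ... | no L≰k = decidable-stable (_ ≤? _) (Graph.Step.absurd G ρ k′ L uL free (≰⇒> L≰k)
    (λ uM M⊆L M<L → ih G uM (λ P c (u , s) → free P c (u , M⊆L ∘ s)) (≤-trans M<L (≤-pred L≤b)))
    (λ x∈L y∈L x≢y e free′ → let more = AddRed.total-increases G x≢y e r x∈L y∈L in
      ≤-trans (<⇒≤ more) (saturation ih m (addRed G x≢y) uL free′ L≤b
        (≤-trans room (≤-trans (≤-reflexive (sym (+-suc m _))) (+-monoʳ-≤ m more))))))

  bounded : ∀ b → Bounded b
  bounded zero G uL free ()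
  bounded (suc b) G {L} uL free L≤b = saturation (bounded b) (suc (weight (length L))) G uL free L≤b (s≤s (m≤m+n _ _))

-- The counts in the statement as counts over lists

filterᵇ-filterᵇ : ∀ (p q : A → Bool) L → filterᵇ p (filterᵇ q L) ≡ filterᵇ (λ x → q x ∧ p x) L
filterᵇ-filterᵇ p q [] = refl
filterᵇ-filterᵇ p q (x ∷ L) with q x
... | false = filterᵇ-filterᵇ p q L
... | true with p x
...   | true = cong (x ∷_) (filterᵇ-filterᵇ p q L)
...   | false = filterᵇ-filterᵇ p q L

length-filterᵇ-map : ∀ (p : B → Bool) (h : A → B) L → length (filterᵇ p (map h L)) ≡ length (filterᵇ (p ∘ h) L)
length-filterᵇ-map p h L = trans (cong length (filterᵇ-map p h L)) (length-map h (filterᵇ (p ∘ h) L))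

filter-≟-true : ∀ (p : A → Bool) L → filter (λ x → p x Bool.≟ true) L ≡ filterᵇ p L
filter-≟-true p [] = refl
filter-≟-true p (x ∷ L) with p x
... | true = cong (x ∷_) (filter-≟-true p L)
... | false = filter-≟-true p L

allFin-suc : ∀ n → allFin (suc n) ≡ zero ∷ map suc (allFin n)
allFin-suc n = cong (zero ∷_) (sym (map-tabulate (λ i → i) suc))

restrict : ∀ {n} → (Fin (suc n) → Fin (suc n) → Bool) → Fin n → Fin n → Bool
restrict E i j = E (suc i) (suc j)

-- Tests for an r-clique inside Q along the recursion of `cliques`: Q shrinks to the neighbourhood
-- of each chosen vertex just as the list does there. This is why the induction in `count-selects`
-- needs an arbitrary Q.
selects : ∀ {n} → (Fin n → Fin n → Bool) → (Fin n → Bool) → ℕ → Vec Bool n → Bool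
selects E Q zero    []          = true
selects E Q (suc r) []          = false
selects E Q r       (false ∷ S) = selects (restrict E) (Q ∘ suc) r S
selects E Q zero    (true ∷ S)  = false
selects E Q (suc r) (true ∷ S)  = Q zero ∧ selects (restrict E) (λ i → Q (suc i) ∧ E zero (suc i)) r S

selects-false : ∀ {n} (E : Fin (suc n) → Fin (suc n) → Bool) Q r S →
  selects E Q r (false ∷ S) ≡ selects (restrict E) (Q ∘ suc) r S
selects-false E Q zero S = refl
selects-false E Q (suc r) S = refl

count-selects : ∀ n (E : Fin n → Fin n → Bool) Q r →
  length (filterᵇ (selects E Q r) (allSubsets n)) ≡ cliques E r (filterᵇ Q (allFin n))
count-selects zero E Q zero = refl
count-selects zero E Q (suc r) = refl
count-selects (suc n) E Q r = begin
  length (filterᵇ (selects E Q r) (map (false ∷_) SS ++ map (true ∷_) SS))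
    ≡⟨ cong length (filterᵇ-++ (selects E Q r) (map (false ∷_) SS) (map (true ∷_) SS)) ⟩
  length (filterᵇ (selects E Q r) (map (false ∷_) SS) ++ filterᵇ (selects E Q r) (map (true ∷_) SS))
    ≡⟨ length-++ (filterᵇ (selects E Q r) (map (false ∷_) SS)) ⟩
  length (filterᵇ (selects E Q r) (map (false ∷_) SS)) + length (filterᵇ (selects E Q r) (map (true ∷_) SS))
    ≡⟨ cong₂ _+_ (without r) (withZero r) ⟩
  cliques E r (filterᵇ Q (map suc (allFin n))) + extra r
    ≡⟨ combine r ⟩
  cliques E r (filterᵇ Q (zero ∷ map suc (allFin n)))
    ≡⟨ cong (λ L → cliques E r (filterᵇ Q L)) (allFin-suc n) ⟨
  cliques E r (filterᵇ Q (allFin (suc n))) ∎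
  where
  open ≡-Reasoning
  SS = allSubsets n
  extra : ℕ → ℕ
  extra zero = 0
  extra (suc r) = if Q zero then cliques E r (filterᵇ (E zero) (filterᵇ Q (map suc (allFin n)))) else 0
  without : ∀ r → length (filterᵇ (selects E Q r) (map (false ∷_) SS)) ≡ cliques E r (filterᵇ Q (map suc (allFin n)))
  without r = begin
    length (filterᵇ (selects E Q r) (map (false ∷_) SS))
      ≡⟨ length-filterᵇ-map (selects E Q r) (false ∷_) SS ⟩
    length (filterᵇ (selects E Q r ∘ (false ∷_)) SS)
      ≡⟨ cong length (filterᵇ-cong (selects-false E Q r) SS) ⟩
    length (filterᵇ (selects (restrict E) (Q ∘ suc) r) SS)
      ≡⟨ count-selects n (restrict E) (Q ∘ suc) r ⟩
    cliques (restrict E) r (filterᵇ (Q ∘ suc) (allFin n))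
      ≡⟨ cliques-map suc r (filterᵇ (Q ∘ suc) (allFin n)) ⟨
    cliques E r (map suc (filterᵇ (Q ∘ suc) (allFin n)))
      ≡⟨ cong (cliques E r) (filterᵇ-map Q suc (allFin n)) ⟨
    cliques E r (filterᵇ Q (map suc (allFin n))) ∎
  withZero : ∀ r → length (filterᵇ (selects E Q r) (map (true ∷_) SS)) ≡ extra r
  withZero zero = trans (length-filterᵇ-map (selects E Q zero) (true ∷_) SS)
    (cong length (filterᵇ-none {p = λ _ → false} (All.universal (λ _ → refl) SS)))
  withZero (suc r) = trans (length-filterᵇ-map (selects E Q (suc r)) (true ∷_) SS) cases
    where
    Q′ : Fin n → Bool
    Q′ i = Q (suc i) ∧ E zero (suc i)
    cases : length (filterᵇ (λ S → Q zero ∧ selects (restrict E) Q′ r S) SS) ≡ extra (suc r)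
    cases with Q zero
    ... | false = cong length (filterᵇ-none {p = λ _ → false} (All.universal (λ _ → refl) SS))
    ... | true = begin
      length (filterᵇ (selects (restrict E) Q′ r) SS)        ≡⟨ count-selects n (restrict E) Q′ r ⟩
      cliques (restrict E) r (filterᵇ Q′ (allFin n))          ≡⟨ cliques-map suc r (filterᵇ Q′ (allFin n)) ⟨
      cliques E r (map suc (filterᵇ Q′ (allFin n)))           ≡⟨ cong (cliques E r) (filterᵇ-map (λ i → Q i ∧ E zero i) suc (allFin n)) ⟨
      cliques E r (filterᵇ (λ i → Q i ∧ E zero i) (map suc (allFin n)))
        ≡⟨ cong (cliques E r) (filterᵇ-filterᵇ (E zero) Q (map suc (allFin n))) ⟨
      cliques E r (filterᵇ (E zero) (filterᵇ Q (map suc (allFin n)))) ∎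
  combine : ∀ r → cliques E r (filterᵇ Q (map suc (allFin n))) + extra r ≡ cliques E r (filterᵇ Q (zero ∷ map suc (allFin n)))
  combine zero = refl
  combine (suc r) with Q zero
  ... | true = refl
  ... | false = +-identityʳ _

bool-ext : ∀ {a b} → (a ≡ true → b ≡ true) → (b ≡ true → a ≡ true) → a ≡ b
bool-ext {false} {false} f h = refl
bool-ext {false} {true} f h = h refl
bool-ext {true} f h = sym (f refl)

record IsClique {n} (E : Fin n → Fin n → Bool) (Q : Fin n → Bool) (r : ℕ) (S : Vec Bool n) : Set where
  constructor isClique
  field
    size≡ : size S ≡ r
    within : ∀ i → lookupᵛ S i ≡ true → Q i ≡ true
    edge : ∀ i j → lookupᵛ S i ≡ true → lookupᵛ S j ≡ true → i ≢ j → E i j ≡ true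

selects⇒ : ∀ {n} {E : Fin n → Fin n → Bool} → (∀ i j → E i j ≡ E j i) → ∀ {Q} r S → selects E Q r S ≡ true → IsClique E Q r S
selects⇒ E-sym zero [] _ = isClique refl (λ ()) (λ ())
selects⇒ {suc n} {E} E-sym {Q} r (false ∷ S) h
  with isClique sz win ed ← selects⇒ {E = restrict E} (λ i j → E-sym (suc i) (suc j)) {Q ∘ suc} r S
    (trans (sym (selects-false E Q r S)) h) =
  isClique sz (λ { (suc i) → win i }) λ { (suc i) (suc j) si sj i≢j → ed i j si sj (i≢j ∘ cong suc) }
selects⇒ {suc n} {E} E-sym {Q} (suc r) (true ∷ S) h with q , h′ ← ∧-true {Q zero} h
  with isClique sz win ed ← selects⇒ {E = restrict E} (λ i j → E-sym (suc i) (suc j)) r S h′ =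
  isClique (cong suc sz) (λ { zero _ → q ; (suc i) si → proj₁ (∧-true (win i si)) })
    λ { zero zero _ _ 0≢0 → contradiction refl 0≢0
      ; zero (suc j) _ sj _ → proj₂ (∧-true {Q (suc j)} (win j sj))
      ; (suc i) zero si _ _ → trans (E-sym (suc i) zero) (proj₂ (∧-true {Q (suc i)} (win i si)))
      ; (suc i) (suc j) si sj i≢j → ed i j si sj (i≢j ∘ cong suc) }

selects⇐ : ∀ {n} {E : Fin n → Fin n → Bool} {Q} r S → IsClique E Q r S → selects E Q r S ≡ true
selects⇐ zero [] _ = refl
selects⇐ (suc r) [] (isClique () _ _)
selects⇐ {E = E} {Q} r (false ∷ S) (isClique sz win ed) = trans (selects-false E Q r S) (selects⇐ r S
  (isClique sz (win ∘ suc) (λ i j si sj i≢j → ed (suc i) (suc j) si sj (i≢j ∘ Fin-suc-injective))))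
selects⇐ {E = E} (suc r) (true ∷ S) (isClique sz win ed) = cong₂ _∧_ (win zero refl) (selects⇐ r S
  (isClique (suc-injective sz) (λ i si → cong₂ _∧_ (win (suc i) si) (ed zero (suc i) refl si λ ()))
    (λ i j si sj i≢j → ed (suc i) (suc j) si sj (i≢j ∘ Fin-suc-injective))))

allB⇒ : ∀ {p : A → Bool} {L x} → allB p L ≡ true → x ∈ L → p x ≡ true
allB⇒ h (here refl) = proj₁ (∧-true h)
allB⇒ {p = p} {y ∷ L} h (there x∈L) = allB⇒ (proj₂ (∧-true {p y} h)) x∈L

allB⇐ : ∀ {p : A → Bool} L → (∀ x → p x ≡ true) → allB p L ≡ true
allB⇐ [] h = refl
allB⇐ (x ∷ L) h = cong₂ _∧_ (h x) (allB⇐ L h)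

module Link {n} (G : RBGraph n) where
  open Coloured (col G)

  blueClique⇒ : ∀ S → blueClique G S ≡ true → ∀ i j → lookupᵛ S i ≡ true → lookupᵛ S j ≡ true → i ≢ j → blueE i j ≡ true
  blueClique⇒ S h i j si sj i≢j with allB⇒ (allB⇒ h (∈-allFin i)) (∈-allFin j)
  ... | e rewrite si | sj with i ≟ᶠ j
  ...   | yes i≡j = contradiction i≡j i≢j
  ...   | no _ = e

  blueClique⇐ : ∀ S → (∀ i j → lookupᵛ S i ≡ true → lookupᵛ S j ≡ true → i ≢ j → blueE i j ≡ true) → blueClique G S ≡ true
  blueClique⇐ S h = allB⇐ (allFin n) λ i → allB⇐ (allFin n) λ j → entry i j
    where
    entry : ∀ i j → not (lookupᵛ S i ∧ lookupᵛ S j ∧ not ⌊ i ≟ᶠ j ⌋) ∨ blueE i j ≡ true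
    entry i j with lookupᵛ S i in si | lookupᵛ S j in sj | i ≟ᶠ j
    ... | false | _ | _ = refl
    ... | true | false | _ = refl
    ... | true | true | yes _ = refl
    ... | true | true | no i≢j = h i j si sj i≢j

  blueCliques≡cliques : ∀ r → blueCliques r G ≡ cliques blueE r (allFin n)
  blueCliques≡cliques r = begin
    blueCliques r G
      ≡⟨ cong length (filter-≟-true (λ S → ⌊ size S ≟ r ⌋ ∧ blueClique G S) (allSubsets n)) ⟩
    length (filterᵇ (λ S → ⌊ size S ≟ r ⌋ ∧ blueClique G S) (allSubsets n))
      ≡⟨ cong length (filterᵇ-cong (λ S → bool-ext (to S) (from S)) (allSubsets n)) ⟩
    length (filterᵇ (selects blueE (λ _ → true) r) (allSubsets n))
      ≡⟨ count-selects n blueE (λ _ → true) r ⟩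
    cliques blueE r (filterᵇ (λ _ → true) (allFin n))
      ≡⟨ cong (cliques blueE r) (filterᵇ-all (All.universal (λ _ → refl) (allFin n))) ⟩
    cliques blueE r (allFin n) ∎
    where
    open ≡-Reasoning
    to : ∀ S → ⌊ size S ≟ r ⌋ ∧ blueClique G S ≡ true → selects blueE (λ _ → true) r S ≡ true
    to S h with size S ≟ r
    ... | yes sz = selects⇐ r S (isClique sz (λ _ _ → refl) (blueClique⇒ S h))
    from : ∀ S → selects blueE (λ _ → true) r S ≡ true → ⌊ size S ≟ r ⌋ ∧ blueClique G S ≡ true
    from S h with isClique sz _ ed ← selects⇒ (λ i j → cong isBlue (symm G i j)) r S h with size S ≟ r
    ... | yes _ = blueClique⇐ S ed
    ... | no sz≢ = contradiction sz sz≢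

pairCount : (A → B → Bool) → List A → List B → ℕ
pairCount p [] M = 0
pairCount p (x ∷ L) M = length (filterᵇ (p x) M) + pairCount p L M

length-filterᵇ-pairs : ∀ (p : A → B → Bool) L M →
  length (filterᵇ (λ xy → p (proj₁ xy) (proj₂ xy)) (concatMap (λ x → map (x ,_) M) L)) ≡ pairCount p L M
length-filterᵇ-pairs p [] M = refl
length-filterᵇ-pairs {A = A} {B = B} p (x ∷ L) M = begin
  length (filterᵇ p′ (map (x ,_) M ++ rest))                        ≡⟨ cong length (filterᵇ-++ p′ (map (x ,_) M) rest) ⟩
  length (filterᵇ p′ (map (x ,_) M) ++ filterᵇ p′ rest)             ≡⟨ length-++ (filterᵇ p′ (map (x ,_) M)) ⟩
  length (filterᵇ p′ (map (x ,_) M)) + length (filterᵇ p′ rest)     ≡⟨ cong₂ _+_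
      (length-filterᵇ-map p′ (x ,_) M) (length-filterᵇ-pairs p L M) ⟩
  length (filterᵇ (p x) M) + pairCount p L M                        ∎
  where
  open ≡-Reasoning
  p′ : A × B → Bool
  p′ xy = p (proj₁ xy) (proj₂ xy)
  rest = concatMap (λ x → map (x ,_) M) L

increasing : ∀ {n} → (Fin n → Fin n → Bool) → Fin n → Fin n → Bool
increasing E i j = does (i <ᶠ? j) ∧ E i j

-- Row zero counts the edges at the first vertex, column zero is empty because no index lies below
-- zero, and the remaining square is the same count for one vertex less.
count-increasing : ∀ n (E : Fin n → Fin n → Bool) → pairCount (increasing E) (allFin n) (allFin n) ≡ cliques E 2 (allFin n)
count-increasing zero E = refl
count-increasing (suc n) E = begin
  pairCount (increasing E) (allFin (suc n)) (allFin (suc n))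
    ≡⟨ cong (λ L → pairCount (increasing E) L L) (allFin-suc n) ⟩
  length (filterᵇ (increasing E zero) (map suc Fs)) + pairCount (increasing E) (map suc Fs) (zero ∷ map suc Fs)
    ≡⟨ cong₂ _+_ row (trans (rows Fs) (count-increasing n (restrict E))) ⟩
  cliques E 1 (filterᵇ (E zero) (map suc Fs)) + cliques (restrict E) 2 Fs
    ≡⟨ +-comm _ (cliques (restrict E) 2 Fs) ⟩
  cliques (restrict E) 2 Fs + cliques E 1 (filterᵇ (E zero) (map suc Fs))
    ≡⟨ cong (_+ cliques E 1 (filterᵇ (E zero) (map suc Fs))) (cliques-map suc 2 Fs) ⟨
  cliques E 2 (zero ∷ map suc Fs)
    ≡⟨ cong (cliques E 2) (allFin-suc n) ⟨
  cliques E 2 (allFin (suc n)) ∎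
  where
  open ≡-Reasoning
  Fs = allFin n
  row : length (filterᵇ (increasing E zero) (map suc Fs)) ≡ cliques E 1 (filterᵇ (E zero) (map suc Fs))
  row = trans (cong length (trans (filterᵇ-map (increasing E zero) suc Fs) (sym (filterᵇ-map (E zero) suc Fs))))
    (sym (cliques-one E (filterᵇ (E zero) (map suc Fs))))
  rows : ∀ L → pairCount (increasing E) (map suc L) (zero ∷ map suc Fs) ≡ pairCount (increasing (restrict E)) L Fs
  rows [] = refl
  rows (i ∷ L) = cong₂ _+_ (length-filterᵇ-map (increasing E (suc i)) suc Fs) (rows L)

redEdges≡cliques : ∀ {n} (G : RBGraph n) → redEdges G ≡ cliques (Coloured.redE (col G)) 2 (allFin n)
redEdges≡cliques {n} G = trans (cong length (filter-≟-true (λ ij → increasing redE (proj₁ ij) (proj₂ ij))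
    (concatMap (λ i → map (i ,_) (allFin n)) (allFin n))))
  (trans (length-filterᵇ-pairs (increasing redE) (allFin n) (allFin n)) (count-increasing n redE))
  where open Coloured (col G)

g≡total : ∀ {n} r (G : RBGraph n) → g r G ≡ Coloured.total (col G) r (allFin n)
g≡total r G = cong₂ _+_ (Link.blueCliques≡cliques G r) (redEdges≡cliques G)

lookup-injective : ∀ {L : List A} → Unique L → ∀ {i j} → lookup L i ≡ lookup L j → i ≡ j
lookup-injective (_ ∷ _) {zero} {zero} e = refl
lookup-injective {L = _ ∷ L} (x∉ ∷ _) {zero} {suc j} e = contradiction e (All.lookup x∉ (∈-lookup {xs = L} j))
lookup-injective {L = _ ∷ L} (x∉ ∷ _) {suc i} {zero} e = contradiction (sym e) (All.lookup x∉ (∈-lookup {xs = L} i))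
lookup-injective (_ ∷ u) {suc i} {suc j} e = cong suc (lookup-injective u e)

linked-lookup : ∀ {R : A → A → Set} {L} → Linked R L → ∀ {i j} → toℕ j ≡ suc (toℕ i) → R (lookup L i) (lookup L j)
linked-lookup (e ∷ c) {zero} {suc zero} _ = e
linked-lookup (e ∷ c) {suc i} {suc j} eq = linked-lookup c (suc-injective eq)
linked-lookup [-] {zero} {zero} ()
linked-lookup (_ ∷ _) {zero} {zero} ()
linked-lookup (_ ∷ _) {zero} {suc (suc _)} ()
linked-lookup (_ ∷ _) {suc _} {zero} ()

pathFree⇒ : ∀ {n} (G : RBGraph n) k → PathFree k G → PathFreeOn G k (allFin n)
pathFree⇒ G k free P chain (unique , _) long = free
  -- A chain that is longer than necessary is cut to its first k + 1 vertices.
  ( (λ i → lookup P (inject≤ i long))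
  , (λ e → inject≤-injective long long _ _ (lookup-injective unique e))
  , λ i → edge (linked-lookup chain (trans (toℕ-inject≤ (suc i) long)
      (cong suc (sym (trans (toℕ-inject≤ (inject₁ i) long) (toℕ-inject₁ i)))))))
  where
  edge : ∀ {c} → isEdge c ≡ true → c ≢ none
  edge h refl = contradiction h λ ()

-- The extremal graph: disjoint monochromatic cliques

range : ℕ → ℕ → List ℕ
range a zero = []
range a (suc m) = a ∷ range (suc a) m

length-range : ∀ a m → length (range a m) ≡ m
length-range a zero = refl
length-range a (suc m) = cong suc (length-range (suc a) m)

range-++ : ∀ a m n → range a (m + n) ≡ range a m ++ range (a + m) n
range-++ a zero n = cong (λ b → range b n) (sym (+-identityʳ a))
range-++ a (suc m) n = cong (a ∷_) (trans (range-++ (suc a) m n) (cong (λ b → range (suc a) m ++ range b n) (sym (+-suc a m))))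

tabulate-range : ∀ a n → tabulate (λ (i : Fin n) → a + toℕ i) ≡ range a n
tabulate-range a zero = refl
tabulate-range a (suc n) = cong₂ _∷_ (+-identityʳ a)
  (trans (tabulate-cong (λ i → +-suc a (toℕ i))) (tabulate-range (suc a) n))

all-range : ∀ {P : ℕ → Set} a m → (∀ {x} → a ≤ x → x < a + m → P x) → All P (range a m)
all-range a zero h = []
all-range a (suc m) h = h ≤-refl (m<m+n a (s≤s z≤n)) ∷
  all-range (suc a) m (λ {x} a<x x< → h (<⇒≤ a<x) (subst (x <_) (sym (+-suc a m)) x<))

allPairs-range : ∀ {R : ℕ → ℕ → Set} a m → (∀ {x y} → a ≤ x → x < y → y < a + m → R x y) → AllPairs R (range a m)
allPairs-range a zero h = []
allPairs-range a (suc m) h =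
  all-range (suc a) m (λ {y} a<y y< → h ≤-refl a<y (subst (y <_) (sym (+-suc a m)) y<)) ∷
  allPairs-range (suc a) m (λ {x} {y} a<x x<y y< → h (<⇒≤ a<x) x<y (subst (y <_) (sym (+-suc a m)) y<))

module Construction (ρ k′ p q : ℕ) (q<k : q < suc k′) (r+2≤k : 2 + (2 + ρ) ≤ suc k′) where
  open Weights ρ

  k : ℕ
  k = suc k′

  -- The colour in which a clique on q vertices weighs more; at q = r + 2 both weigh the same.
  lastColour : Col
  lastColour = if ⌊ 2 + r ≤? q ⌋ then blue else red

  blockColour : ℕ → Col
  blockColour b = if ⌊ b <? p ⌋ then blue else lastColour

  colour : ℕ → ℕ → Col
  colour x y = if ⌊ x ≟ y ⌋ then none else (if ⌊ x / k ≟ y / k ⌋ then blockColour (x / k) else none)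

  colour-sym : ∀ x y → colour x y ≡ colour y x
  colour-sym x y with x ≟ y | y ≟ x
  ... | yes _ | yes _ = refl
  ... | yes refl | no h = contradiction refl h
  ... | no h | yes refl = contradiction refl h
  ... | no _ | no _ with x / k ≟ y / k | y / k ≟ x / k
  ...   | yes e | yes _ = cong blockColour e
  ...   | yes e | no h = contradiction (sym e) h
  ...   | no h | yes e = contradiction (sym e) h
  ...   | no _ | no _ = refl

  colour-irrefl : ∀ x → colour x x ≡ none
  colour-irrefl x with x ≟ x
  ... | yes _ = refl
  ... | no h = contradiction refl h

  colour-block : ∀ {x y b} → x < y → x / k ≡ b → y / k ≡ b → colour x y ≡ blockColour b
  colour-block {x} {y} x<y refl ey with x ≟ y
  ... | yes refl = contradiction x<y (<-irrefl refl)
  ... | no _ with x / k ≟ y / k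
  ...   | yes _ = refl
  ...   | no h = contradiction (sym ey) h

  colour-apart : ∀ {x y} → x / k < y / k → colour x y ≡ none
  colour-apart {x} {y} h with x ≟ y
  ... | yes _ = refl
  ... | no _ with x / k ≟ y / k
  ...   | yes e = contradiction e (<⇒≢ h)
  ...   | no _ = refl

  n : ℕ
  n = p * k + q

  G : RBGraph n
  G = record
    { col = λ i j → colour (toℕ i) (toℕ j)
    ; symm = λ i j → colour-sym (toℕ i) (toℕ j)
    ; irr = λ i → colour-irrefl (toℕ i) }

  adjacent⇒block : ∀ {x y} → colour x y ≢ none → x / k ≡ y / k
  adjacent⇒block {x} {y} h with x ≟ y
  ... | yes refl = refl
  ... | no _ with x / k ≟ y / k
  ...   | yes e = e
  ...   | no _ = contradiction refl h

  -- A path stays in one block, where a vertex is determined by its residue modulo k; among k + 1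
  -- vertices two share a residue.
  G-pathFree : PathFree k G
  G-pathFree (v , v-injective , edges) with i , j , i<j , e ← pigeonhole (n<1+n k) (λ i → fromℕ< (m%n<n (toℕ (v i)) k)) =
    <⇒≢ i<j (cong toℕ (v-injective (toℕ-injective (begin
      toℕ (v i)                                    ≡⟨ m≡m%n+[m/n]*n (toℕ (v i)) k ⟩
      toℕ (v i) % k + toℕ (v i) / k * k            ≡⟨ cong₂ (λ a b → a + b * k) (fromℕ<-injective _ _ _ _ e) (trans (same i) (sym (same j))) ⟩
      toℕ (v j) % k + toℕ (v j) / k * k            ≡⟨ m≡m%n+[m/n]*n (toℕ (v j)) k ⟨
      toℕ (v j)                                    ∎))))
    where
    open ≡-Reasoning
    same : ∀ i → toℕ (v i) / k ≡ toℕ (v zero) / k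
    same = <-weakInduction _ refl (λ i e → trans (sym (adjacent⇒block {toℕ (v (inject₁ i))} {toℕ (v (suc i))} (edges i))) e)

  block-index : ∀ {b x} → b * k ≤ x → x < b * k + k → x / k ≡ b
  block-index {b} {x} lo hi = ≤-antisym
    (≤-pred (m<n*o⇒m/o<n (subst (x <_) (+-comm (b * k) k) hi)))
    (≤-trans (≤-reflexive (sym (m*n/n≡m b k))) (/-monoˡ-≤ k lo))

  open Coloured colour

  monochromatic : ∀ {b a m} → b * k ≤ a → a + m ≤ b * k + k → ∀ {c} → blockColour b ≡ c → AllPairs (λ x y → colour x y ≡ c) (range a m)
  monochromatic {b} {a} {m} lo hi eq = allPairs-range a m (λ a≤x x<y y< → trans
    (colour-block x<y (block-index (≤-trans lo a≤x) (≤-trans (<-trans x<y y<) hi))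
                      (block-index (≤-trans lo (≤-trans a≤x (<⇒≤ x<y))) (≤-trans y< hi))) eq)

  total-blue : ∀ {L} → AllPairs (λ x y → colour x y ≡ blue) L → total r L ≡ binom (length L) r
  total-blue h = trans (cong₂ _+_ (cliques-complete r (AllPairs.map (cong isBlue) h)) (cliques-edgeless 0 (AllPairs.map (cong isRed) h)))
    (+-identityʳ _)

  total-red : ∀ {L} → AllPairs (λ x y → colour x y ≡ red) L → total r L ≡ binom (length L) 2
  total-red h = cong₂ _+_ (cliques-edgeless ρ (AllPairs.map (cong isBlue) h)) (cliques-complete 2 (AllPairs.map (cong isRed) h))

  fullBlock : ∀ {b} → b < p → total r (range (b * k) k) ≡ weight k
  fullBlock {b} b<p = trans (total-blue (monochromatic {b} ≤-refl ≤-refl isblue))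
    (trans (cong (λ l → binom l r) (length-range (b * k) k)) (sym (weight-large r+2≤k)))
    where
    isblue : blockColour b ≡ blue
    isblue with b <? p
    ... | yes _ = refl
    ... | no h = contradiction b<p h

  blockColour-last : blockColour p ≡ lastColour
  blockColour-last with p <? p
  ... | yes h = contradiction h (<-irrefl refl)
  ... | no _ = refl

  lastColour-large : 2 + r ≤ q → lastColour ≡ blue
  lastColour-large large with 2 + r ≤? q
  ... | yes _ = refl
  ... | no h = contradiction large h

  lastColour-small : ¬ (2 + r ≤ q) → lastColour ≡ red
  lastColour-small small with 2 + r ≤? q
  ... | yes h = contradiction h small
  ... | no _ = refl

  lastBlock : total r (range (p * k) q) ≡ weight q
  lastBlock = cases (2 + r ≤? q)
    where
    mono : ∀ {c} → lastColour ≡ c → AllPairs (λ x y → colour x y ≡ c) (range (p * k) q)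
    mono eq = monochromatic {p} ≤-refl (+-monoʳ-≤ (p * k) (<⇒≤ q<k)) (trans blockColour-last eq)
    cases : Dec (2 + r ≤ q) → total r (range (p * k) q) ≡ weight q
    cases (yes large) = trans (total-blue (mono (lastColour-large large)))
      (trans (cong (λ l → binom l r) (length-range (p * k) q)) (sym (weight-large large)))
    cases (no small) = trans (total-red (mono (lastColour-small small)))
      (trans (cong (λ l → binom l 2) (length-range (p * k) q)) (sym (weight-small (≰⇒> small))))

  -- Starting at an arbitrary block b lets the induction split off the first of the j full blocks
  -- that remain.
  total-blocks : ∀ b j → b + j ≡ p → total r (range (b * k) (j * k + q)) ≡ j * weight k + weight q
  total-blocks b zero e rewrite trans (sym (+-identityʳ b)) e = lastBlock
  total-blocks b (suc j) e = begin
    total r (range (b * k) (k + j * k + q))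
      ≡⟨ cong (λ m → total r (range (b * k) m)) (+-assoc k (j * k) q) ⟩
    total r (range (b * k) (k + (j * k + q)))
      ≡⟨ cong (total r) (range-++ (b * k) k (j * k + q)) ⟩
    total r (range (b * k) k ++ range (b * k + k) (j * k + q))
      ≡⟨ total-++ (suc ρ) (range (b * k) k) (all-range (b * k) k λ lo hi → all-range (b * k + k) _ λ lo′ _ → apart lo hi lo′) ⟩
    total r (range (b * k) k) + total r (range (b * k + k) (j * k + q))
      ≡⟨ cong₂ _+_ (fullBlock b<p) (trans (cong (λ a → total r (range a (j * k + q))) (+-comm (b * k) k))
           (total-blocks (suc b) j (trans (sym (+-suc b j)) e))) ⟩
    weight k + (j * weight k + weight q)
      ≡⟨ +-assoc (weight k) _ _ ⟨
    suc j * weight k + weight q ∎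
    where
    open ≡-Reasoning
    b<p : b < p
    b<p = ≤-trans (m<m+n b (s≤s z≤n)) (≤-reflexive e)
    apart : ∀ {x y} → b * k ≤ x → x < b * k + k → b * k + k ≤ y → adj x y ≡ false
    apart {x} {y} lo hi lo′ = cong isEdge (colour-apart {x} {y} (≤-trans (s≤s (≤-reflexive (block-index {b} lo hi)))
      (≤-trans (≤-reflexive (sym (m*n/n≡m (suc b) k))) (/-monoˡ-≤ k (subst (_≤ y) (+-comm (b * k) k) lo′)))))

  g-G : g r G ≡ p * weight k + weight q
  g-G = begin
    g r G                                                     ≡⟨ g≡total r G ⟩
    Coloured.total (col G) r (allFin n)                       ≡⟨ cong₂ _+_ (cliques-map toℕ r (allFin n)) (cliques-map toℕ 2 (allFin n)) ⟨
    total r (map toℕ (allFin n))                              ≡⟨ cong (total r) (trans (map-tabulate (λ i → i) toℕ) (tabulate-range 0 n)) ⟩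
    total r (range 0 n)                                       ≡⟨ total-blocks 0 p refl ⟩
    p * weight k + weight q                                   ∎
    where open ≡-Reasoning

-- The stated bound in terms of weights, and the theorem

bound≡ : ∀ ρ {k} p q → 2 + (2 + ρ) ≤ k → bound (2 + ρ) k p q ≡ p * Weights.weight ρ k + Weights.weight ρ q
bound≡ ρ {k} p q r+2≤k = cong₂ (λ a b → p * a + b) (trans (sym (binom≡C k r)) (sym (weight-large r+2≤k))) last
  where
  open Weights ρ
  last : (if ⌊ 2 + r ≤? q ⌋ then q C r else q C 2) ≡ weight q
  last with 2 + r ≤? q
  ... | yes large = trans (sym (binom≡C q r)) (sym (weight-large large))
  ... | no small = trans (sym (binom≡C q 2)) (sym (weight-small (≰⇒> small)))

theorem3p4 : (r k p q : ℕ) → 2 ≤ r → r + 2 ≤ k → q < k →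
    ((G : RBGraph (p * k + q)) → PathFree k G → g r G ≤ bound r k p q)
    × Σ (RBGraph (p * k + q)) (λ G → PathFree k G × g r G ≡ bound r k p q)
theorem3p4 (suc (suc ρ)) (suc k′) p q _ r+2≤k q<k = upper , G , G-pathFree , trans g-G (sym (bound≡ ρ p q 2+r≤k))
  where
  open Weights ρ
  open Extremal (suc k′)
  2+r≤k : 2 + r ≤ suc k′
  2+r≤k = subst (_≤ suc k′) (+-comm r 2) r+2≤k
  open Construction ρ k′ p q q<k 2+r≤k using (n; G; G-pathFree; g-G)
  upper : (G : RBGraph n) → PathFree (suc k′) G → g r G ≤ bound r (suc k′) p q
  upper G free = begin
    g r G                                    ≡⟨ g≡total r G ⟩
    Coloured.total (col G) r (allFin n)      ≤⟨ UpperBound.bounded ρ k′ _ G (allFin⁺ n) (pathFree⇒ G (suc k′) free) ≤-refl ⟩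
    extremal (length (allFin n))             ≡⟨ cong extremal {length (allFin n)} {n} (length-tabulate (λ i → i)) ⟩
    extremal (p * suc k′ + q)                ≡⟨ extremal-block p q<k ⟩
    p * weight (suc k′) + weight q           ≡⟨ bound≡ ρ p q 2+r≤k ⟨
    bound r (suc k′) p q                     ∎
    where open ≤-Reasoning
theorem3p4 (suc zero) k p q (s≤s ()) _ _
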